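{- Let $G$ be a connected graph on $n\ge 3$ vertices, and let $k\ge 0$ and $r\in\{0,1,2,3\}$ be integers with $\kappa(G)=4k+r$. Then $\kappa_3(G)\geq 3k+\lceil r/2\rceil$. Moreover, this lower bound is sharp: for all integers $k\ge 0$ and $r\in\{0,1,2,3\}$ with $4k+r\ge 1$ there exists a connected graph $G$ with $\kappa(G)=4k+r$ and $\kappa_3(G)=3k+\lceil r/2\rceil$.
   Context: All graphs are finite and simple. $\kappa(G)$ denotes the (vertex) connectivity of $G$: the minimum cardinality of a vertex set $Q$ such that $G-Q$ is disconnected or trivial. For a set $S$ of vertices of a connected graph $G$, a tree connecting $S$ is a subtree of $G$ containing all vertices of $S$; $\kappa(S)$ denotes the maximum number $\ell$ of edge-disjoint trees $T_1,\ldots,T_\ell$ in $G$, each connecting $S$, such that $V(T_i)\cap V(T_j)=S$ for all distinct $i,j$. The $3$-connectivity is $\kappa_3(G)=\min\{\kappa(S): S\subseteq V(G),\ |S|=3\}$. -}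

module Defs where

open import Data.Nat using (ℕ; zero; suc; _≤_)
open import Data.Bool using (Bool; true; false)
open import Data.Fin using (Fin)
open import Data.Fin.Subset using (Subset; _∈_; ∣_∣; ∁; ⊤)
open import Data.List using (List; []; _∷_; _++_; [_]; length)
open import Data.List.Relation.Unary.Unique.Propositional using (Unique)
open import Data.Product using (Σ; ∃; _×_; _,_)
open import Data.Sum using (_⊎_)
open import Data.Unit using () renaming (⊤ to Unit)
open import Relation.Nullary using (¬_)
open import Relation.Binary.PropositionalEquality using (_≡_)

record Graph (n : ℕ) : Set where
  field
    adj    : Fin n → Fin n → Bool
    sym    : ∀ u v → adj u v ≡ adj v u
    irrefl : ∀ u → adj u u ≡ false
open Graph public

data Walk {n : ℕ} (E : Fin n → Fin n → Bool) (U : Subset n) : Fin n → Fin n → Set where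
  here : ∀ {u} → u ∈ U → Walk E U u u
  step : ∀ {u w v} → u ∈ U → E u w ≡ true → Walk E U w v → Walk E U u v

ConnectedOn : {n : ℕ} → (Fin n → Fin n → Bool) → Subset n → Set
ConnectedOn E U = ∀ u v → u ∈ U → v ∈ U → Walk E U u v

ConnectedGraph : {n : ℕ} → Graph n → Set
ConnectedGraph {n} G = Σ (Fin n) (λ _ → Unit) × ConnectedOn (adj G) ⊤

Separates : {n : ℕ} → Graph n → Subset n → Set
Separates G Q = (¬ ConnectedOn (adj G) (∁ Q)) ⊎ (∣ ∁ Q ∣ ≤ 1)

IsConnectivity : {n : ℕ} → Graph n → ℕ → Set
IsConnectivity {n} G m =
  (∃ λ (Q : Subset n) → ∣ Q ∣ ≡ m × Separates G Q) ×
  (∀ (Q : Subset n) → Separates G Q → m ≤ ∣ Q ∣)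

Linked : {n : ℕ} → (Fin n → Fin n → Bool) → List (Fin n) → Set
Linked E [] = Unit
Linked E (x ∷ []) = Unit
Linked E (x ∷ y ∷ xs) = (E x y ≡ true) × Linked E (y ∷ xs)

HasCycle : {n : ℕ} → (Fin n → Fin n → Bool) → Set
HasCycle {n} E =
  ∃ λ (x : Fin n) → ∃ λ (xs : List (Fin n)) →
    2 ≤ length xs × Unique (x ∷ xs) × Linked E (x ∷ xs ++ [ x ])

record Subgraph {n : ℕ} (G : Graph n) : Set where
  field
    verts   : Subset n
    edges   : Fin n → Fin n → Bool
    esym    : ∀ u v → edges u v ≡ edges v u
    eInG    : ∀ u v → edges u v ≡ true → adj G u v ≡ true
    eInV    : ∀ u v → edges u v ≡ true → u ∈ verts
open Subgraph public

IsTree : {n : ℕ} {G : Graph n} → Subgraph G → Set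
IsTree T = ConnectedOn (edges T) (verts T) × ¬ HasCycle (edges T)

HasTrees : {n : ℕ} → (G : Graph n) → Subset n → ℕ → Set
HasTrees {n} G S ℓ =
  Σ (Fin ℓ → Subgraph G) λ T →
    (∀ i → IsTree (T i)) ×
    (∀ i v → v ∈ S → v ∈ verts (T i)) ×
    (∀ i j → ¬ i ≡ j → ∀ v → v ∈ verts (T i) → v ∈ verts (T j) → v ∈ S) ×
    (∀ i j → ¬ i ≡ j → ∀ u v → edges (T i) u v ≡ true → edges (T j) u v ≡ false)

Kappa3AtLeast : {n : ℕ} → Graph n → ℕ → Set
Kappa3AtLeast {n} G b = ∀ (S : Subset n) → ∣ S ∣ ≡ 3 → HasTrees G S b

Kappa3Is : {n : ℕ} → Graph n → ℕ → Set
Kappa3Is {n} G b =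
  Kappa3AtLeast G b × (∃ λ (S : Subset n) → ∣ S ∣ ≡ 3 × ¬ HasTrees G S (suc b))

{-# OPTIONS --safe #-}

-- Lower bound (element connectivity, after Hind and Oellermann).  Fix three
-- terminals and subdivide the edges between them.  Every set of non-terminals
-- separating one terminal from the other two has at least m = κ(G) elements.
-- For an edge between non-terminals this property survives either its deletion
-- or its contraction, by uncrossing a small cut of one with a small cut of the
-- other.  Trees lift back along both operations, so all these edges can be
-- removed.  Then every vertex adjacent to all terminals is a tree, and so is
-- every pair of vertices that miss different terminals.  If F vertices miss
-- none and Mᵢ vertices miss exactly terminal i, the cut condition says
-- m ≤ F + Mⱼ + Mₖ, and it gives b trees whenever b ≤ m and 4b ≤ 3m + 1.
--
-- Sharpness.  Join three independent terminals to a clique on m + ⌈m/2⌉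
-- vertices, each of which misses exactly one terminal.  Every tree uses at
-- least two clique vertices.

module Submission where

open import Data.Bool using (Bool; true; false; _∧_; _∨_; not; if_then_else_)
import Data.Bool as Bool
open import Data.Bool.Properties using (∧-assoc; ∧-comm; ∨-comm; ∨-zeroʳ)
open import Data.Fin using (Fin; zero; suc; _↑ˡ_; _↑ʳ_; splitAt; combine; remQuot)
open import Data.Fin.Patterns using (0F; 1F; 2F)
open import Data.Fin.Permutation using (transpose; _⟨$⟩ʳ_)
open import Data.Fin.Properties
  using (_≟_; any?; all?; suc-injective; splitAt-↑ˡ; splitAt-↑ʳ; injective⇒≤; combine-remQuot)
open import Data.Fin.Subset using (Subset; ∣_∣; ⊤; ⊥; _∈_; ∁; inside; outside)
open import Data.Fin.Subset.Properties using (anySubset?; ∣⊥∣≡0; ∉⊥; ∣∁p∣≡n∸∣p∣)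
open import Data.List using (List; []; _∷_; _++_; [_]; allFin)
open import Data.List.Membership.Propositional using () renaming (_∈_ to _∈ₗ_)
open import Data.List.Membership.Propositional.Properties using (∈-allFin)
open import Data.List.Relation.Unary.All as All using (All; []; _∷_)
open import Data.List.Relation.Unary.AllPairs using ([]; _∷_)
open import Data.List.Relation.Unary.Any using (here; there)
open import Data.List.Relation.Unary.Unique.Propositional using (Unique)
open import Data.Nat using (ℕ; zero; suc; _+_; _*_; _∸_; _≤_; _<_; z≤n; s≤s; ⌈_/2⌉; ⌊_/2⌋)
open import Data.Nat.Properties hiding (_≟_; suc-injective)
open import Algebra.Properties.CommutativeMonoid.Sum +-0-commutativeMonoid
  using (sum; sum-cong-≗; ∑-distrib-+; sum-permute)
open import Data.Nat.Tactic.RingSolver using (solve-∀)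
open import Data.Product using (∃; Σ-syntax; _×_; _,_; proj₁; proj₂)
open import Data.Sum using (_⊎_; inj₁; inj₂; [_,_]′)
open import Data.Unit using (tt)
open import Data.Vec using ([]; _∷_; here; there; lookup; tabulate)
open import Data.Vec.Properties
  using (lookup∘tabulate; tabulate∘lookup; lookup⇒[]=; []=⇒lookup; tabulate-∘)
open import Defs renaming (sym to adj-sym)
open import Function using (_∘_; case_of_)
open import Relation.Binary.PropositionalEquality
  using (_≡_; _≢_; refl; sym; trans; cong; cong₂; subst; subst₂)
open import Relation.Nullary using (¬_; Dec; yes; no; does; contradiction)
open import Relation.Nullary.Decidable
  using (map′; _×-dec_; _⊎-dec_; _→-dec_; ¬?; dec-true; dec-false; from-yes)

-- Non-terminals alone cannot separate adjacent terminals. Subdivision removes this obstacle and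
-- turns an edge between terminals into one more vertex to be packed; since a non-terminal lies in
-- at most one tree, vertex-disjoint packing then yields edge-disjoint trees as well. One of
-- deletion and contraction is always safe because a violating cut of the deletion has fewer than
-- `m` elements and one of the contraction pulls back to at most `m`, while uncrossing turns them
-- into two cuts of the original net, with at least `2m` elements in total. The factor 3/4 comes
-- from a weight: 2 for a vertex attached to all terminals, 1 for a vertex that misses exactly one.
-- A tree costs weight 2, and the sum of the three cut inequalities shows that the total weight is
-- at least `3m/2`. Until the end only vertex sets are packed, with connectedness tested by
-- two-colourings; actual trees are extracted once, in the given graph.

private variable
  n m b : ℕ

-- Booleans and cardinalities of Boolean sets.

∧-elim : ∀ x {y} → x ∧ y ≡ true → x ≡ true × y ≡ true
∧-elim true {true} _ = refl , refl

∧-intro : ∀ {x y} → x ≡ true → y ≡ true → x ∧ y ≡ true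
∧-intro refl refl = refl

∨-elim : ∀ {x y} → x ∨ y ≡ true → x ≡ true ⊎ y ≡ true
∨-elim {true}  _ = inj₁ refl
∨-elim {false} h = inj₂ h

∨-introˡ : ∀ {x y} → x ≡ true → x ∨ y ≡ true
∨-introˡ refl = refl

∨-introʳ : ∀ {x y} → y ≡ true → x ∨ y ≡ true
∨-introʳ {x} refl = ∨-zeroʳ x

not-elim : ∀ {x} → not x ≡ true → x ≢ true
not-elim {false} _ ()

does-elim : ∀ {p} {P : Set p} (d : Dec P) → does d ≡ true → P
does-elim (yes p) _ = p

true-or-false : ∀ x → x ≡ true ⊎ x ≡ false
true-or-false true  = inj₁ refl
true-or-false false = inj₂ refl

bit : Bool → ℕ
bit true  = 1
bit false = 0

bit-mono : ∀ {x y} → (x ≡ true → y ≡ true) → bit x ≤ bit y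
bit-mono {false} _ = z≤n
bit-mono {true}  h rewrite h refl = ≤-refl

sum-mono : {f g : Fin n → ℕ} → (∀ v → f v ≤ g v) → sum f ≤ sum g
sum-mono {zero}  h = z≤n
sum-mono {suc n} h = +-mono-≤ (h zero) (sum-mono (h ∘ suc))

abstract
  size : (Fin n → Bool) → ℕ
  size f = sum (bit ∘ f)

  size-mono : {f g : Fin n → Bool} → (∀ v → f v ≡ true → g v ≡ true) → size f ≤ size g
  size-mono h = sum-mono (λ v → bit-mono (h v))

  size-cong : {f g : Fin n → Bool} → (∀ v → f v ≡ g v) → size f ≡ size g
  size-cong h = sum-cong-≗ (λ v → cong bit (h v))

  -- This reduces submodularity to a truth table at a single vertex.
  size-exchange : (f g h k : Fin n → Bool) → (∀ v → bit (f v) + bit (g v) ≤ bit (h v) + bit (k v)) →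
                  size f + size g ≤ size h + size k
  size-exchange f g h k le =
    subst₂ _≤_ (∑-distrib-+ (bit ∘ f) (bit ∘ g)) (∑-distrib-+ (bit ∘ h) (bit ∘ k)) (sum-mono le)

  size-empty : size {n} (λ _ → false) ≡ 0
  size-empty {zero}  = refl
  size-empty {suc n} = size-empty {n}

  size-singleton : (q : Fin n) → size (λ v → does (v ≟ q)) ≡ 1
  size-singleton {suc n} zero    = cong suc (size-empty {n})
  size-singleton {suc n} (suc q) = trans (size-cong h) (size-singleton q)
    where
    h : ∀ v → does (suc v ≟ suc q) ≡ does (v ≟ q)
    h v with v ≟ q
    ... | yes _ = refl
    ... | no _  = refl

  size-insert : {f g : Fin n → Bool} (q : Fin n) →
                (∀ v → v ≢ q → f v ≡ true → g v ≡ true) → size f ≤ suc (size g)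
  size-insert {n} {f} {g} q h = subst₂ _≤_ (trans (cong (size f +_) (size-empty {n})) (+-identityʳ _))
    (trans (cong (size g +_) (size-singleton q)) (+-comm (size g) 1))
    (size-exchange f (λ _ → false) g (λ v → does (v ≟ q)) pointwise)
    where
    pointwise : ∀ v → bit (f v) + 0 ≤ bit (g v) + bit (does (v ≟ q))
    pointwise v with v ≟ q | f v in eq
    ... | _     | false = z≤n
    ... | yes _ | true  = m≤n+m 1 (bit (g v))
    ... | no ne | true  = subst (λ x → 1 ≤ bit x + 0) (sym (h v ne eq)) ≤-refl

  size-cover : {f g h k : Fin n → Bool} → (∀ v → bit (f v) ≤ bit (g v) + (bit (h v) + bit (k v))) →
               size f ≤ size g + (size h + size k)
  size-cover {f = f} {g} {h} {k} le = ≤-trans (sum-mono le) (≤-reflexive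
    (trans (∑-distrib-+ (bit ∘ g) _) (cong (size g +_) (∑-distrib-+ (bit ∘ h) (bit ∘ k)))))

  size-full : size {n} (λ _ → true) ≡ n
  size-full {zero}  = refl
  size-full {suc n} = cong suc (size-full {n})

  size-++ : ∀ k (f : Fin (k + n) → Bool) → size f ≡ size (f ∘ (_↑ˡ n)) + size (f ∘ (k ↑ʳ_))
  size-++ zero    f = refl
  size-++ (suc k) f = trans (cong (bit (f zero) +_) (size-++ k (f ∘ suc))) (sym (+-assoc (bit (f zero)) _ _))

  size-strict : {f g : Fin n → Bool} (q : Fin n) → (∀ v → f v ≡ true → g v ≡ true) →
                f q ≢ true → g q ≡ true → size f < size g
  size-strict {n} {f} {g} q h ¬fq gq = subst₂ _≤_
    (trans (cong (size f +_) (size-singleton q)) (+-comm (size f) 1))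
    (trans (cong (size g +_) (size-empty {n})) (+-identityʳ _))
    (size-exchange f (λ v → does (v ≟ q)) g (λ _ → false) pointwise)
    where
    pointwise : ∀ v → bit (f v) + bit (does (v ≟ q)) ≤ bit (g v) + 0
    pointwise v with v ≟ q | f v in eq
    ... | yes refl | true  = contradiction eq ¬fq
    ... | yes refl | false rewrite gq = ≤-refl
    ... | no _     | false = z≤n
    ... | no _     | true  rewrite h v eq = ≤-refl

  size-permute : (f : Fin n → Bool) (p q : Fin n) → size f ≡ size (f ∘ (transpose p q ⟨$⟩ʳ_))
  size-permute f p q = sum-permute (bit ∘ f) (transpose p q)

  size-nonempty : {f : Fin n → Bool} → 1 ≤ size f → ∃ λ v → f v ≡ true
  size-nonempty {zero}  ()
  size-nonempty {suc n} {f} h with f zero in eq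
  ... | true  = zero , eq
  ... | false = let v , p = size-nonempty {n} {f ∘ suc} h in suc v , p

  ∣tabulate∣ : (f : Fin n → Bool) → ∣ tabulate f ∣ ≡ size f
  ∣tabulate∣ {zero}  f = refl
  ∣tabulate∣ {suc n} f with f zero
  ... | true  = cong suc (∣tabulate∣ (f ∘ suc))
  ... | false = ∣tabulate∣ (f ∘ suc)

-- Nets and their cuts

-- Only the non-terminal vertices are represented; A v i says that v is
-- adjacent to terminal i, and there are no edges between terminals.
record Net (n : ℕ) : Set₁ where
  field
    E     : Fin n → Fin n → Set
    A     : Fin n → Fin 3 → Set
    E?    : ∀ u v → Dec (E u v)
    A?    : ∀ v i → Dec (A v i)
    E-sym : ∀ {u v} → E u v → E v u
open Net

-- U is the side of terminal s, without s itself; Q contains its boundary.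
record IsCut (H : Net n) (s : Fin 3) (U Q : Fin n → Bool) : Set where
  constructor cut
  field
    start  : ∀ v → A H v s → U v ∨ Q v ≡ true
    closed : ∀ u v → U u ≡ true → E H u v → U v ∨ Q v ≡ true
    avoid  : ∀ u i → U u ≡ true → A H u i → i ≡ s

Tough : ℕ → Net n → Set
Tough m H = ∀ s U Q → IsCut H s U Q → m ≤ size Q

isCut? : (H : Net n) → ∀ s U Q → Dec (IsCut H s U Q)
isCut? H s U Q = map′ (λ (x , y , z) → cut x y z) (λ (cut x y z) → x , y , z)
  (all? (λ v → A? H v s →-dec (U v ∨ Q v) Bool.≟ true) ×-dec
   all? (λ u → all? λ v → U u Bool.≟ true →-dec E? H u v →-dec (U v ∨ Q v) Bool.≟ true) ×-dec
   all? (λ u → all? λ i → U u Bool.≟ true →-dec A? H u i →-dec i ≟ s))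

isCut-cong : {H : Net n} {s : Fin 3} {U U' Q Q' : Fin n → Bool} →
             (∀ v → U v ≡ U' v) → (∀ v → Q v ≡ Q' v) → IsCut H s U Q → IsCut H s U' Q'
isCut-cong {U = U} {Q = Q} eU eQ c = cut
  (λ v a → trans (sym (eUQ v)) (c.start v a))
  (λ u v uu e → trans (sym (eUQ v)) (c.closed u v (trans (eU u) uu) e))
  (λ u i uu a → c.avoid u i (trans (eU u) uu) a)
  where
  module c = IsCut c
  eUQ : ∀ v → U v ∨ Q v ≡ _
  eUQ v = cong₂ _∨_ (eU v) (eQ v)

-- There are finitely many pairs of subsets, so a small cut can be searched for. The search runs
-- over vectors; a cut given by functions is carried over pointwise.
tough? : ∀ m (H : Net n) →
         (∃ λ s → ∃ λ U → ∃ λ Q → IsCut H s U Q × size Q < m) ⊎ Tough m H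
tough? m H with any? (λ s → anySubset? λ U → anySubset? λ Q →
                isCut? H s (lookup U) (lookup Q) ×-dec size (lookup Q) <? m)
... | yes (s , U , Q , bad) = inj₁ (s , lookup U , lookup Q , bad)
... | no none = inj₂ λ s U Q c → ≮⇒≥ λ lt → none
  ( s , tabulate U , tabulate Q
  , isCut-cong (λ v → sym (lookup∘tabulate U v)) (λ v → sym (lookup∘tabulate Q v)) c
  , subst (_< m) (size-cong (λ v → sym (lookup∘tabulate Q v))) lt )

-- Deletion, contraction and uncrossing.

-- With a pair for `Z` this removes an edge together with any loops at its ends, which contractions
-- may have created.
delete : (Z : Fin n → Set) → (∀ v → Dec (Z v)) → Net n → Net n
delete Z Z? H = record
  { E     = λ u v → E H u v × ¬ (Z u × Z v)
  ; A     = A H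
  ; E?    = λ u v → E? H u v ×-dec ¬? (Z? u ×-dec Z? v)
  ; A?    = A? H
  ; E-sym = λ (e , z) → E-sym H e , λ (zv , zu) → z (zu , zv)
  }

-- Contraction keeps the vertex type: a vertex outside the range of `π` remains, isolated and
-- attached to no terminal.
image : (Fin n → Fin n) → Net n → Net n
image π H = record
  { E     = λ u v → ∃ λ u' → ∃ λ v' → π u' ≡ u × π v' ≡ v × E H u' v'
  ; A     = λ v i → ∃ λ v' → π v' ≡ v × A H v' i
  ; E?    = λ u v → any? λ u' → any? λ v' → π u' ≟ u ×-dec π v' ≟ v ×-dec E? H u' v'
  ; A?    = λ v i → any? λ v' → π v' ≟ v ×-dec A? H v' i
  ; E-sym = λ (u' , v' , pu , pv , e) → v' , u' , pv , pu , E-sym H e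
  }

isCut-preimage : (π : Fin n → Fin n) {H : Net n} {s : Fin 3} {U Q : Fin n → Bool} →
                 IsCut (image π H) s U Q → IsCut H s (U ∘ π) (Q ∘ π)
isCut-preimage π c = cut
  (λ v a → IsCut.start c (π v) (v , refl , a))
  (λ u v uu e → IsCut.closed c (π u) (π v) uu (u , v , refl , refl , e))
  (λ u i uu a → IsCut.avoid c (π u) i uu (u , refl , a))

-- Sides and separators may overlap. Once the overlap is dropped, the ends of a deleted edge that
-- lie in a separator are not on its side, as uncrossing requires.
isCut-shrink : {H : Net n} {s : Fin 3} {U Q : Fin n → Bool} →
               IsCut H s U Q → IsCut H s (λ v → U v ∧ not (Q v)) Q
isCut-shrink {U = U} {Q} c = cut
  (λ v a → shrink (U v) (Q v) (IsCut.start c v a))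
  (λ u v uu e → shrink (U v) (Q v) (IsCut.closed c u v (proj₁ (∧-elim (U u) uu)) e))
  (λ u i uu a → IsCut.avoid c u i (proj₁ (∧-elim (U u) uu)) a)
  where
  shrink : ∀ x q → x ∨ q ≡ true → (x ∧ not q) ∨ q ≡ true
  shrink true  true  _ = refl
  shrink true  false _ = refl
  shrink false true  _ = refl

-- a, b indicate the sides of two cuts and q, r their separators; meetQ and
-- joinQ cover the boundary of the intersection and the union of the sides,
-- diffQ that of the part of the first side outside b and r.
meetQ joinQ diffQ : (a b q r : Bool) → Bool
meetQ a b q r = (q ∧ b) ∨ (a ∧ r) ∨ (q ∧ r)
joinQ a b q r = (q ∨ r) ∧ not a ∧ not b
diffQ a b q r = not b ∧ (q ∨ (a ∧ r))

meet-cover : ∀ a b q r → a ∨ q ≡ true → b ∨ r ≡ true → (a ∧ b) ∨ meetQ a b q r ≡ true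
meet-cover true  true  _     _    _ _ = refl
meet-cover true  false true  true _ _ = refl
meet-cover true  false false true _ _ = refl
meet-cover false true  true  _    _ _ = refl
meet-cover false false true  true _ _ = refl

join-coverˡ : ∀ a b q r → a ∨ q ≡ true → (a ∨ b) ∨ joinQ a b q r ≡ true
join-coverˡ true  _     _    _ _ = refl
join-coverˡ false true  _    _ _ = refl
join-coverˡ false false true _ _ = refl

join-coverʳ : ∀ a b q r → b ∨ r ≡ true → (a ∨ b) ∨ joinQ a b q r ≡ true
join-coverʳ true  _     _     _    _ = refl
join-coverʳ false true  _     _    _ = refl
join-coverʳ false false true  true _ = refl
join-coverʳ false false false true _ = refl

diff-cover : ∀ a b q r → a ∨ q ≡ true → b ≢ true → (a ∧ not b ∧ not r) ∨ diffQ a b q r ≡ true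
diff-cover _     true  _     _     _ b≢ = contradiction refl b≢
diff-cover true  false _     false _ _  = refl
diff-cover true  false true  true  _ _  = refl
diff-cover true  false false true  _ _  = refl
diff-cover false false true  _     _ _  = refl

meet-join : ∀ a b q r → bit (meetQ a b q r) + bit (joinQ a b q r) ≤ bit q + bit r
meet-join true  true  true  true  = s≤s z≤n
meet-join true  true  true  false = s≤s z≤n
meet-join true  true  false true  = s≤s z≤n
meet-join true  true  false false = z≤n
meet-join true  false true  true  = s≤s z≤n
meet-join true  false true  false = z≤n
meet-join true  false false true  = s≤s z≤n
meet-join true  false false false = z≤n
meet-join false true  true  true  = s≤s z≤n
meet-join false true  true  false = s≤s z≤n
meet-join false true  false true  = z≤n
meet-join false true  false false = z≤n
meet-join false false true  true  = ≤-refl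
meet-join false false true  false = ≤-refl
meet-join false false false true  = ≤-refl
meet-join false false false false = z≤n

diff-diff : ∀ a b q r → bit (diffQ a b q r) + bit (diffQ b a r q) ≤ bit q + bit r
diff-diff true  true  _     _     = z≤n
diff-diff true  false true  true  = s≤s z≤n
diff-diff true  false true  false = s≤s z≤n
diff-diff true  false false true  = s≤s z≤n
diff-diff true  false false false = z≤n
diff-diff false true  true  true  = s≤s z≤n
diff-diff false true  true  false = s≤s z≤n
diff-diff false true  false true  = s≤s z≤n
diff-diff false true  false false = z≤n
diff-diff false false true  true  = ≤-refl
diff-diff false false true  false = ≤-refl
diff-diff false false false true  = ≤-refl
diff-diff false false false false = z≤n

module _ {H : Net n} {Z : Fin n → Set} (Z? : ∀ v → Dec (Z v))
         {s s' : Fin 3} {U U' Q Q' : Fin n → Bool}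
         (c : IsCut (delete Z Z? H) s U Q) (c' : IsCut H s' U' Q')
         (Z⊆Q' : ∀ v → Z v → Q' v ≡ true) (Z∩U' : ∀ v → Z v → U' v ≢ true) where
  private
    module c  = IsCut c
    module c' = IsCut c'

  -- Both new cuts are cuts of `H` itself: a deleted edge has no end in `U'`, so it does not leave
  -- the intersection, and its ends lie in `Q'`, so the union with its separator covers them.
  uncross-same : Tough m H → s ≡ s' → m + m ≤ size Q + size Q'
  uncross-same tough refl = ≤-trans
    (+-mono-≤ (tough s (λ v → U v ∧ U' v) (λ v → meetQ (U v) (U' v) (Q v) (Q' v)) meet)
              (tough s (λ v → U v ∨ U' v) (λ v → joinQ (U v) (U' v) (Q v) (Q' v)) join))
    (size-exchange _ _ _ _ (λ v → meet-join (U v) (U' v) (Q v) (Q' v)))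
    where
    meet : IsCut H s _ _
    meet = cut
      (λ v a → meet-cover (U v) (U' v) (Q v) (Q' v) (c.start v a) (c'.start v a))
      (λ u v uu e → let x , x' = ∧-elim (U u) uu in
        meet-cover (U v) (U' v) (Q v) (Q' v) (c.closed u v x (e , λ (zu , _) → Z∩U' u zu x')) (c'.closed u v x' e))
      (λ u i uu a → c.avoid u i (proj₁ (∧-elim (U u) uu)) a)
    closed : ∀ u v → U u ∨ U' u ≡ true → E H u v → (U v ∨ U' v) ∨ joinQ (U v) (U' v) (Q v) (Q' v) ≡ true
    closed u v uu e with ∨-elim {U u} uu
    ... | inj₂ x' = join-coverʳ (U v) (U' v) (Q v) (Q' v) (c'.closed u v x' e)
    ... | inj₁ x  with true-or-false (Q' v)
    ...   | inj₁ q' = join-coverʳ (U v) (U' v) (Q v) (Q' v) (∨-introʳ {U' v} q')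
    ...   | inj₂ q' = join-coverˡ (U v) (U' v) (Q v) (Q' v)
                        (c.closed u v x (e , λ (_ , zv) → case trans (sym q') (Z⊆Q' v zv) of λ ()))
    avoid : ∀ u i → U u ∨ U' u ≡ true → A H u i → i ≡ s
    avoid u i uu a with ∨-elim {U u} uu
    ... | inj₁ x  = c.avoid u i x a
    ... | inj₂ x' = c'.avoid u i x' a
    join : IsCut H s _ _
    join = cut (λ v a → join-coverˡ (U v) (U' v) (Q v) (Q' v) (c.start v a)) closed avoid

  -- Posimodularity replaces submodularity: each side is reduced by the other cut. No edge runs from
  -- a reduced side into the other side, since by symmetry of `E` its first end would be covered by
  -- the other cut.
  uncross-different : Tough m H → s ≢ s' → m + m ≤ size Q + size Q'
  uncross-different tough s≢ = ≤-trans
    (+-mono-≤ (tough s (λ v → U v ∧ not (U' v) ∧ not (Q' v)) (λ v → diffQ (U v) (U' v) (Q v) (Q' v)) left)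
              (tough s' (λ v → U' v ∧ not (U v) ∧ not (Q v)) (λ v → diffQ (U' v) (U v) (Q' v) (Q v)) right))
    (size-exchange _ _ _ _ (λ v → diff-diff (U v) (U' v) (Q v) (Q' v)))
    where
    uncovered : ∀ {x y} → x ∨ y ≡ true → not x ≡ true → not y ≡ true → ∀ {A : Set} → A
    uncovered {false} {true} _ _ ()

    left : IsCut H s _ _
    left = cut
      (λ v a → diff-cover (U v) (U' v) (Q v) (Q' v) (c.start v a) (λ x' → s≢ (c'.avoid v s x' a)))
      (λ u v uu e → let x , yz = ∧-elim (U u) uu ; y , z = ∧-elim (not (U' u)) yz in
        diff-cover (U v) (U' v) (Q v) (Q' v) (c.closed u v x (e , λ (zu , _) → not-elim z (Z⊆Q' u zu)))
          (λ x' → uncovered {U' u} (c'.closed v u x' (E-sym H e)) y z))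
      (λ u i uu a → c.avoid u i (proj₁ (∧-elim (U u) uu)) a)
    right : IsCut H s' _ _
    right = cut
      (λ v a → diff-cover (U' v) (U v) (Q' v) (Q v) (c'.start v a) (λ x → s≢ (sym (c.avoid v s' x a))))
      (λ u v uu e → let x' , yz = ∧-elim (U' u) uu ; y , z = ∧-elim (not (U u)) yz in
        diff-cover (U' v) (U v) (Q' v) (Q v) (c'.closed u v x' e)
          (λ x → uncovered {U u} (c.closed v u x (E-sym H e , λ (_ , zu) → Z∩U' u zu x')) y z))
      (λ u i uu a → c'.avoid u i (proj₁ (∧-elim (U' u) uu)) a)

  uncross-disjoint : Tough m H → size Q < m → m < size Q'
  uncross-disjoint {m} tough lt = +-cancelˡ-< m _ _ (≤-<-trans le (+-monoˡ-< (size Q') lt))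
    where
    le : m + m ≤ size Q + size Q'
    le with s ≟ s'
    ... | yes eq = uncross-same tough eq
    ... | no ne  = uncross-different tough ne

-- The strict conclusion pays for the one vertex that a separator gains when a cut of the
-- contraction is pulled back.
uncross : {H : Net n} {Z : Fin n → Set} (Z? : ∀ v → Dec (Z v)) {s s' : Fin 3} {U U' Q Q' : Fin n → Bool} →
          Tough m H → IsCut (delete Z Z? H) s U Q → size Q < m →
          IsCut H s' U' Q' → (∀ v → Z v → Q' v ≡ true) → m < size Q'
uncross Z? {U' = U'} tough c lt c' Z⊆Q' = uncross-disjoint Z? c (isCut-shrink c') Z⊆Q'
  (λ v zv x → not-elim (proj₂ (∧-elim (U' v) x)) (Z⊆Q' v zv)) tough lt

Pair : (p q : Fin n) → Fin n → Set
Pair p q v = v ≡ p ⊎ v ≡ q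

pair? : ∀ (p q : Fin n) v → Dec (Pair p q v)
pair? p q v = v ≟ p ⊎-dec v ≟ q

redirect : (p q : Fin n) → Fin n → Fin n
redirect p q v with v ≟ q
... | yes _ = p
... | no _  = v

redirect-q : (p q : Fin n) → redirect p q q ≡ p
redirect-q p q with q ≟ q
... | yes _ = refl
... | no ne = contradiction refl ne

redirect-≢ : ∀ {v} (p q : Fin n) → v ≢ q → redirect p q v ≡ v
redirect-≢ {v = v} p q ne with v ≟ q
... | yes eq = contradiction eq ne
... | no _   = refl

-- An edge whose deletion creates a small cut can be contracted: a small cut of
-- the contraction would have both ends of the edge in its separator, and
-- uncrossing the two cuts rules this out.
contract-tough : {H : Net n} {p q : Fin n} {s : Fin 3} {U Q : Fin n → Bool} → p ≢ q →
                 Tough m H → IsCut (delete (Pair p q) (pair? p q) H) s U Q → size Q < m →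
                 Tough m (image (redirect p q) H)
contract-tough {m = m} {H} {p} {q} p≢q tough c lt s' U' Q' c' with Q' p in eq
... | false = ≤-trans (tough s' _ _ (isCut-preimage (redirect p q) c')) (size-mono h)
  where
  h : ∀ v → Q' (redirect p q v) ≡ true → Q' v ≡ true
  h v x with v ≟ q
  ... | no _  = x
  ... | yes _ = case trans (sym eq) x of λ ()
... | true = ≤-pred (≤-trans (uncross (pair? p q) tough c lt (isCut-preimage (redirect p q) c') h)
                    (size-insert q λ v ne x → subst (λ w → Q' w ≡ true) (redirect-≢ p q ne) x))
  where
  h : ∀ v → Pair p q v → Q' (redirect p q v) ≡ true
  h v (inj₁ refl) = subst (λ w → Q' w ≡ true) (sym (redirect-≢ p q p≢q)) eq
  h v (inj₂ refl) = subst (λ w → Q' w ≡ true) (sym (redirect-q p q)) eq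

-- W connects the terminals: a two-colouring that is constant along the edges
-- inside W together with the terminals gives all terminals the same colour.
Joins : Net n → (Fin n → Bool) → Set
Joins {n} H W = ∀ (X : Fin n → Bool) (t : Fin 3 → Bool) →
  (∀ u v → W u ≡ true → W v ≡ true → E H u v → X u ≡ X v) →
  (∀ v i → W v ≡ true → A H v i → X v ≡ t i) →
  ∀ i j → t i ≡ t j

Disjoint : (Fin b → Fin n → Bool) → Set
Disjoint W = ∀ i j v → W i v ≡ true → W j v ≡ true → i ≡ j

Packed : ℕ → Net n → Set
Packed {n} b H = Σ[ W ∈ (Fin b → Fin n → Bool) ] (∀ i → Joins H (W i)) × Disjoint W

packed-delete : {Z : Fin n → Set} (Z? : ∀ v → Dec (Z v)) (H : Net n) → Packed b (delete Z Z? H) → Packed b H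
packed-delete Z? H (W , joins , disj) =
  W , (λ i X t xe xa → joins i X t (λ u v wu wv (e , _) → xe u v wu wv e) xa) , disj

-- The bundle that contains `p` receives `q` as well, so the contracted edge lies inside it and
-- gives its two ends the same colour.
packed-contract : (H : Net n) {p q : Fin n} → p ≢ q → E H q p → Packed b (image (redirect p q) H) → Packed b H
packed-contract {n} H {p} {q} p≢q e (W , joins , disj) =
  (λ i → W i ∘ π) , lift , λ i j v → disj i j (π v)
  where
  π : Fin n → Fin n
  π = redirect p q
  lift : ∀ i → Joins H (W i ∘ π)
  lift i X t xe xa = joins i X t edge attach
    where
    collapse : ∀ u → W i (π u) ≡ true → X (π u) ≡ X u
    collapse u wu with u ≟ q
    ... | no _     = refl
    ... | yes refl = sym (xe q p
      (subst (λ w → W i w ≡ true) (sym (redirect-q p q)) wu)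
      (subst (λ w → W i w ≡ true) (sym (redirect-≢ p q p≢q)) wu) e)
    edge : ∀ u v → W i u ≡ true → W i v ≡ true → E (image π H) u v → X u ≡ X v
    edge _ _ wu wv (u , v , refl , refl , f) =
      trans (collapse u wu) (trans (xe u v wu wv f) (sym (collapse v wv)))
    attach : ∀ v j → W i v ≡ true → A (image π H) v j → X v ≡ t j
    attach _ j wv (v , refl , a) = trans (collapse v wv) (xa v j wv a)

-- Elimination of all edges between non-terminals.

module Reduction (m b : ℕ)
  (edgeless : (H : Net n) → (∀ u v → ¬ E H u v) → Tough m H → Packed b H) where

  -- L contains all non-isolated vertices and, in reduceAt, all neighbours of q
  -- lie in ps.
  reduce : (L : List (Fin n)) (H : Net n) → (∀ u v → E H u v → u ∈ₗ L) → Tough m H → Packed b H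
  reduceAt : (q : Fin n) (L ps : List (Fin n)) (H : Net n) → (∀ u v → E H u v → u ∈ₗ q ∷ L) →
             (∀ v → E H q v → v ∈ₗ ps) → Tough m H → Packed b H

  reduce []      H live tough = edgeless H (λ u v e → case live u v e of λ ()) tough
  reduce (q ∷ L) H live tough = reduceAt q L (allFin n) H live (λ v _ → ∈-allFin v) tough

  reduceAt q L [] H live nbr tough = reduce L H live′ tough
    where
    live′ : ∀ u v → E H u v → u ∈ₗ L
    live′ u v e with live u v e
    ... | here refl = case nbr v e of λ ()
    ... | there u∈  = u∈
  reduceAt q L (p ∷ ps) H live nbr tough with E? H q p
  ... | no ¬e = reduceAt q L ps H live nbr′ tough
    where
    nbr′ : ∀ v → E H q v → v ∈ₗ ps
    nbr′ v f with nbr v f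
    ... | here refl = contradiction f ¬e
    ... | there v∈  = v∈
  ... | yes e with tough? m (delete (Pair p q) (pair? p q) H)
  ...   | inj₂ tough′ = packed-delete (pair? p q) H
            (reduceAt q L ps _ (λ u v (f , _) → live u v f) nbr′ tough′)
    where
    nbr′ : ∀ v → E (delete (Pair p q) (pair? p q) H) q v → v ∈ₗ ps
    nbr′ v (f , nz) with nbr v f
    ... | here refl = contradiction (inj₂ refl , inj₁ refl) nz
    ... | there v∈  = v∈
  ...   | inj₁ (s , U , Q , c , lt) with p ≟ q
  -- Deleting a loop changes no boundary, so it cannot create a small cut.
  ...     | yes refl = contradiction (tough s U Q loopless) (<⇒≱ lt)
    where
    loopless : IsCut H s U Q
    loopless = cut (IsCut.start c) closed (IsCut.avoid c)
      where
      closed : ∀ u v → U u ≡ true → E H u v → U v ∨ Q v ≡ true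
      closed u v uu f with u ≟ v
      ... | yes refl = ∨-introˡ uu
      ... | no u≢v   = IsCut.closed c u v uu (f , λ (x , y) → u≢v (trans (one x) (sym (one y))))
        where
        one : ∀ {w} → Pair p p w → w ≡ p
        one (inj₁ x) = x
        one (inj₂ x) = x
  -- Contraction may give `p` new neighbours, but it isolates `q`; so `L` gets shorter and the list
  -- of candidate neighbours may start afresh.
  ...     | no p≢q = packed-contract H p≢q e
            (reduce L (image (redirect p q) H) live′ (contract-tough p≢q tough c lt))
    where
    in-L : ∀ u v → E H u v → redirect p q u ∈ₗ L
    in-L u v f with u ≟ q
    ... | no u≢q with live u v f
    ...   | here u≡q = contradiction u≡q u≢q
    ...   | there u∈ = u∈
    in-L u v f | yes refl with live p q (E-sym H e)
    ...   | here p≡q = contradiction p≡q p≢q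
    ...   | there p∈ = p∈
    live′ : ∀ u v → E (image (redirect p q) H) u v → u ∈ₗ L
    live′ _ _ (u , v , refl , refl , f) = in-L u v f

-- Edgeless nets

Σ₃ : (Fin 3 → ℕ) → ℕ
Σ₃ p = p 0F + p 1F + p 2F

Σ₃-mono : {p q : Fin 3 → ℕ} → (∀ i → p i ≤ q i) → Σ₃ p ≤ Σ₃ q
Σ₃-mono h = +-mono-≤ (+-mono-≤ (h 0F) (h 1F)) (h 2F)

-- The rotations suffice to put any chosen terminal in any chosen position.
data Triple : Fin 3 → Fin 3 → Fin 3 → Set where
  t012 : Triple 0F 1F 2F
  t120 : Triple 1F 2F 0F
  t201 : Triple 2F 0F 1F

triple-Σ₃ : ∀ {i j k} → Triple i j k → ∀ p → Σ₃ p ≡ p i + p j + p k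
triple-Σ₃ t012 p = refl
triple-Σ₃ t120 p = rot (p 0F) (p 1F) (p 2F)
  where
  rot : ∀ x y z → x + y + z ≡ y + z + x
  rot = solve-∀
triple-Σ₃ t201 p = rot (p 0F) (p 1F) (p 2F)
  where
  rot : ∀ x y z → x + y + z ≡ z + x + y
  rot = solve-∀

triple-cover : ∀ {i j k} → Triple i j k → ∀ a → a ≡ i ⊎ a ≡ j ⊎ a ≡ k
triple-cover t012 0F = inj₁ refl
triple-cover t012 1F = inj₂ (inj₁ refl)
triple-cover t012 2F = inj₂ (inj₂ refl)
triple-cover t120 0F = inj₂ (inj₂ refl)
triple-cover t120 1F = inj₁ refl
triple-cover t120 2F = inj₂ (inj₁ refl)
triple-cover t201 0F = inj₂ (inj₁ refl)
triple-cover t201 1F = inj₂ (inj₂ refl)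
triple-cover t201 2F = inj₁ refl

triple-≢ : ∀ {i j k} → Triple i j k → i ≢ j
triple-≢ t012 ()
triple-≢ t120 ()
triple-≢ t201 ()

triple-≢′ : ∀ {i j k} → Triple i j k → i ≢ k
triple-≢′ t012 ()
triple-≢′ t120 ()
triple-≢′ t201 ()

triple-≢″ : ∀ {i j k} → Triple i j k → j ≢ k
triple-≢″ t012 ()
triple-≢″ t120 ()
triple-≢″ t201 ()

rotate : ∀ {i j k} → Triple i j k → Triple j k i
rotate t012 = t120
rotate t120 = t201
rotate t201 = t012

others : ∀ i → ∃ λ j → ∃ λ k → Triple i j k
others 0F = _ , _ , t012
others 1F = _ , _ , t120
others 2F = _ , _ , t201

third : ∀ (i j : Fin 3) → ∃ λ k → i ≢ k × j ≢ k
third = from-yes (all? {3} λ i → all? {3} λ j → any? {3} λ k → ¬? (i ≟ k) ×-dec ¬? (j ≟ k))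

minimum : (p : Fin 3 → ℕ) → ∃ λ i → ∃ λ j → ∃ λ k → Triple i j k × p k ≤ p i × p k ≤ p j
minimum p with ≤-total (p 0F) (p 1F) | ≤-total (p 0F) (p 2F) | ≤-total (p 1F) (p 2F)
... | inj₁ x | inj₁ y | _      = _ , _ , _ , t120 , x , y
... | inj₁ x | inj₂ y | _      = _ , _ , _ , t012 , y , ≤-trans y x
... | inj₂ x | _      | inj₁ z = _ , _ , _ , t201 , z , x
... | inj₂ x | _      | inj₂ z = _ , _ , _ , t012 , ≤-trans z x , z

-- Otherwise `x + y ≤ suc b`, so the first hypothesis gives `suc b ≤ z`; as `z` is smallest, `x + y`
-- is at least `2 * suc b`, a contradiction.
two-largest : ∀ {b x y z} → suc b + suc b ≤ x + y + z → suc b + z ≤ x + y + z → z ≤ x → z ≤ y →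
              suc (suc b) + z ≤ x + y + z
two-largest {b} {x} {y} {z} h2 h1 zx zy with suc (suc b) ≤? x + y
... | yes le = +-monoˡ-≤ z le
... | no nle = contradiction
    (≤-trans (≤-trans (+-mono-≤ b<z b<z) (+-mono-≤ zx zy)) (≤-pred (≰⇒> nle)))
    (m+1+n≰m (suc b))
  where
  b<z : suc b ≤ z
  b<z = +-cancelˡ-≤ (suc b) _ _ (≤-trans h2 (+-monoˡ-≤ z (≤-pred (≰⇒> nle))))

positive : ∀ {b x z} → suc b ≤ x + z → z ≤ x → 1 ≤ x
positive {x = suc x} _ _ = s≤s z≤n
positive {x = zero} {zero} () _

module Packing {n} (full : Fin n → Bool) (miss : Fin 3 → Fin n → Bool)
  (full-miss : ∀ {v i} → full v ≡ true → miss i v ≢ true)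
  (miss-unique : ∀ {v i j} → miss i v ≡ true → miss j v ≡ true → i ≡ j) where

  Good : (Fin n → Bool) → Set
  Good W = (∃ λ v → W v ≡ true × full v ≡ true) ⊎
           (∃ λ i → ∃ λ j → ∃ λ u → ∃ λ v → i ≢ j ×
              W u ≡ true × miss i u ≡ true × W v ≡ true × miss j v ≡ true)

  Bundles : ℕ → (Fin n → Bool) → Set
  Bundles b S = Σ[ W ∈ (Fin b → Fin n → Bool) ]
    (∀ i → Good (W i)) × (∀ i v → W i v ≡ true → S v ≡ true) × Disjoint W

  extend : (S W₀ : Fin n → Bool) → Good W₀ → (∀ v → W₀ v ≡ true → S v ≡ true) →
           Bundles b (λ v → S v ∧ not (W₀ v)) → Bundles (suc b) S
  extend {b} S W₀ good₀ sub₀ (W , good , sub , disj) = W′ , good′ , sub′ , disj′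
    where
    W′ : Fin (suc b) → Fin n → Bool
    W′ zero    = W₀
    W′ (suc i) = W i
    good′ : ∀ i → Good (W′ i)
    good′ zero    = good₀
    good′ (suc i) = good i
    sub′ : ∀ i v → W′ i v ≡ true → S v ≡ true
    sub′ zero    v w = sub₀ v w
    sub′ (suc i) v w = proj₁ (∧-elim (S v) (sub i v w))
    disj′ : Disjoint W′
    disj′ zero    zero    v _ _ = refl
    disj′ zero    (suc j) v w x = contradiction w (not-elim (proj₂ (∧-elim (S v) (sub j v x))))
    disj′ (suc i) zero    v w x = contradiction x (not-elim (proj₂ (∧-elim (S v) (sub i v w))))
    disj′ (suc i) (suc j) v w x = cong suc (disj i j v w x)

  # : (Fin n → Bool) → (Fin n → Bool) → ℕ
  # S f = size (λ v → S v ∧ f v)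

  #-restrict : (S R f : Fin n → Bool) → # (λ v → S v ∧ R v) f ≤ # S f
  #-restrict S R f = size-mono λ v x → let y , z = ∧-elim (S v ∧ R v) x in ∧-intro (proj₁ (∧-elim (S v) y)) z

  -- Greedy choice under two necessary conditions: the weight suffices for all trees, and each tree
  -- needs a vertex outside any given class `miss k`. Full vertices go first; then a pair comes from
  -- the two largest classes, which preserves the second condition.
  pack : ∀ b S → b + b ≤ # S full + # S full + Σ₃ (# S ∘ miss) →
         (∀ k → b + # S (miss k) ≤ # S full + Σ₃ (# S ∘ miss)) → Bundles b S
  pack zero    S _ _ = (λ ()) , (λ ()) , (λ ()) , λ ()
  pack (suc b) S h₂ h₁ with # S full in eqF
  ... | suc F = extend S W₀ (inj₁ (v , dec-true (v ≟ v) refl , fv)) sub₀ (pack b S′ h₂′ h₁′)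
    where
    pick : ∃ λ v → S v ∧ full v ≡ true
    pick = size-nonempty (subst (1 ≤_) (sym eqF) (s≤s z≤n))
    v : Fin n
    v = proj₁ pick
    fv : full v ≡ true
    fv = proj₂ (∧-elim (S v) (proj₂ pick))
    W₀ S′ : Fin n → Bool
    W₀ w = does (w ≟ v)
    S′ w = S w ∧ not (W₀ w)
    sub₀ : ∀ w → W₀ w ≡ true → S w ≡ true
    sub₀ w x with refl ← does-elim (w ≟ v) x = proj₁ (∧-elim (S v) (proj₂ pick))
    keep : ∀ {w f} → w ≢ v → S w ∧ f w ≡ true → S′ w ∧ f w ≡ true
    keep {w} ne x = let s , y = ∧-elim (S w) x in
      ∧-intro (∧-intro s (cong not (dec-false (w ≟ v) ne))) y
    F≤ : F ≤ # S′ full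
    F≤ = ≤-pred (subst (_≤ suc (# S′ full)) eqF (size-insert v λ w ne → keep {w} {full} ne))
    miss≤ : ∀ i → # S (miss i) ≤ # S′ (miss i)
    miss≤ i = size-mono λ w x → keep {w} {miss i} (λ { refl → full-miss fv (proj₂ (∧-elim (S w) x)) }) x
    h₂′ : b + b ≤ # S′ full + # S′ full + Σ₃ (# S′ ∘ miss)
    h₂′ = ≤-trans (≤-pred (≤-pred (subst₂ _≤_ (cong suc (+-suc b b))
                                          (cong (λ x → suc x + Σ₃ (# S ∘ miss)) (+-suc F F)) h₂)))
                  (+-mono-≤ (+-mono-≤ F≤ F≤) (Σ₃-mono miss≤))
    h₁′ : ∀ k → b + # S′ (miss k) ≤ # S′ full + Σ₃ (# S′ ∘ miss)
    h₁′ k = ≤-trans (+-monoʳ-≤ b (#-restrict S _ (miss k)))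
              (≤-trans (≤-pred (h₁ k)) (+-mono-≤ F≤ (Σ₃-mono miss≤)))
  ... | zero with i , j , k , t , ki , kj ← minimum (# S ∘ miss) =
    extend S W₀ (inj₂ (i , j , u , v , triple-≢ t , ∨-introˡ (dec-true (u ≟ u) refl) , mu
                                             , ∨-introʳ {does (v ≟ u)} (dec-true (v ≟ v) refl) , mv))
      sub₀ (pack b S′ h₂′ h₁′)
    where
    p : Fin 3 → ℕ
    p = # S ∘ miss
    Σ≡ : Σ₃ p ≡ p i + p j + p k
    Σ≡ = triple-Σ₃ t p
    shuffle : ∀ x y z → x + y + z ≡ x + z + y
    shuffle = solve-∀
    shuffle′ : ∀ x y z → x + y + z ≡ y + z + x
    shuffle′ = solve-∀
    -- The second condition for class `j` leaves `suc b ≤ p i + p k`, and `p k ≤ p i`, so class `i`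
    -- is nonempty.
    pick-i : ∃ λ u → S u ∧ miss i u ≡ true
    pick-i = size-nonempty (positive {b}
      (+-cancelʳ-≤ (p j) _ _ (subst (suc b + p j ≤_) (trans Σ≡ (shuffle (p i) (p j) (p k))) (h₁ j))) ki)
    pick-j : ∃ λ v → S v ∧ miss j v ≡ true
    pick-j = size-nonempty (positive {b}
      (+-cancelʳ-≤ (p i) _ _ (subst (suc b + p i ≤_) (trans Σ≡ (shuffle′ (p i) (p j) (p k))) (h₁ i))) kj)
    u v : Fin n
    u = proj₁ pick-i
    v = proj₁ pick-j
    mu : miss i u ≡ true
    mu = proj₂ (∧-elim (S u) (proj₂ pick-i))
    mv : miss j v ≡ true
    mv = proj₂ (∧-elim (S v) (proj₂ pick-j))
    W₀ S′ : Fin n → Bool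
    W₀ w = does (w ≟ u) ∨ does (w ≟ v)
    S′ w = S w ∧ not (W₀ w)
    sub₀ : ∀ w → W₀ w ≡ true → S w ≡ true
    sub₀ w x with ∨-elim {does (w ≟ u)} x
    ... | inj₁ y with refl ← does-elim (w ≟ u) y = proj₁ (∧-elim (S u) (proj₂ pick-i))
    ... | inj₂ y with refl ← does-elim (w ≟ v) y = proj₁ (∧-elim (S v) (proj₂ pick-j))
    p′ : Fin 3 → ℕ
    p′ = # S′ ∘ miss
    keep : ∀ {w f} → w ≢ u → w ≢ v → S w ∧ f w ≡ true → S′ w ∧ f w ≡ true
    keep {w} nu nv x = let s , y = ∧-elim (S w) x in
      ∧-intro (∧-intro s (cong not (cong₂ _∨_ (dec-false (w ≟ u) nu) (dec-false (w ≟ v) nv)))) y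
    lose : ∀ {w f} → W₀ w ≡ true → S′ w ∧ f w ≢ true
    lose {w} w₀ x = not-elim (proj₂ (∧-elim (S w) (proj₁ (∧-elim (S′ w) x)))) w₀
    shrink : ∀ a → p′ a ≤ p a
    shrink a = #-restrict S _ (miss a)
    i≤ : p i ≤ suc (p′ i)
    i≤ = size-insert u λ w nu x → keep {w} {miss i} nu
      (λ { refl → triple-≢ t (miss-unique (proj₂ (∧-elim (S w) x)) mv) }) x
    j≤ : p j ≤ suc (p′ j)
    j≤ = size-insert v λ w nv x → keep {w} {miss j}
      (λ { refl → triple-≢ t (miss-unique mu (proj₂ (∧-elim (S w) x))) }) nv x
    i< : suc (p′ i) ≤ p i
    i< = size-strict u (λ w x → let y , z = ∧-elim (S′ w) x in ∧-intro (proj₁ (∧-elim (S w) y)) z)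
      (lose {f = miss i} (∨-introˡ (dec-true (u ≟ u) refl))) (proj₂ pick-i)
    j< : suc (p′ j) ≤ p j
    j< = size-strict v (λ w x → let y , z = ∧-elim (S′ w) x in ∧-intro (proj₁ (∧-elim (S w) y)) z)
      (lose {f = miss j} (∨-introʳ {does (v ≟ u)} (dec-true (v ≟ v) refl))) (proj₂ pick-j)
    k≤ : p k ≤ p′ k
    k≤ = size-mono λ w x → keep {w} {miss k}
      (λ { refl → triple-≢′ t (miss-unique mu (proj₂ (∧-elim (S w) x))) })
      (λ { refl → triple-≢″ t (miss-unique mv (proj₂ (∧-elim (S w) x))) }) x
    Σ≤ : Σ₃ p ≤ suc (suc (Σ₃ p′))
    Σ≤ = subst₂ _≤_ (sym Σ≡)
      (cong suc (trans (cong (_+ p′ k) (+-suc (p′ i) (p′ j))) (cong suc (sym (triple-Σ₃ t p′)))))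
      (+-mono-≤ (+-mono-≤ i≤ j≤) k≤)
    h₂′ : b + b ≤ # S′ full + # S′ full + Σ₃ p′
    h₂′ = ≤-trans (≤-pred (≤-pred (≤-trans (subst (_≤ Σ₃ p) (cong suc (+-suc b b)) h₂) Σ≤)))
                  (m≤n+m (Σ₃ p′) (# S′ full + # S′ full))
    slack : ∀ {a} → suc (suc b) + p′ a ≤ Σ₃ p → b + p′ a ≤ # S′ full + Σ₃ p′
    slack le = ≤-trans (≤-pred (≤-pred (≤-trans le Σ≤))) (m≤n+m (Σ₃ p′) (# S′ full))
    h₁′ : ∀ a → b + p′ a ≤ # S′ full + Σ₃ p′
    h₁′ a with triple-cover t a
    ... | inj₁ refl = slack {i} (≤-trans (≤-reflexive (sym (+-suc (suc b) (p′ i))))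
                                        (≤-trans (+-monoʳ-≤ (suc b) i<) (h₁ i)))
    ... | inj₂ (inj₁ refl) = slack {j} (≤-trans (≤-reflexive (sym (+-suc (suc b) (p′ j))))
                                        (≤-trans (+-monoʳ-≤ (suc b) j<) (h₁ j)))
    -- Class `k` keeps its size while the sum drops by two; this is where the choice of the two
    -- largest classes matters.
    ... | inj₂ (inj₂ refl) = slack {k} (≤-trans (+-monoʳ-≤ (suc (suc b)) (shrink k))
      (subst (suc (suc b) + p k ≤_) (sym Σ≡)
        (two-largest {b} (subst (suc b + suc b ≤_) Σ≡ h₂) (subst (suc b + p k ≤_) Σ≡ (h₁ k)) ki kj)))

-- With no edges left, the vertices attached to terminal s and to another one
-- form a cut; so at least m vertices are of this kind for each s.
module Edgeless (m b : ℕ) (b≤m : b ≤ m) (4b≤ : 4 * b ≤ suc (3 * m))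
  (H : Net n) (no-edge : ∀ u v → ¬ E H u v) (tough : Tough m H) where

  att : Fin n → Fin 3 → Bool
  att v i = does (A? H v i)

  full : Fin n → Bool
  full v = att v 0F ∧ att v 1F ∧ att v 2F

  miss : Fin 3 → Fin n → Bool
  miss 0F v = not (att v 0F) ∧ att v 1F ∧ att v 2F
  miss 1F v = not (att v 1F) ∧ att v 2F ∧ att v 0F
  miss 2F v = not (att v 2F) ∧ att v 0F ∧ att v 1F

  miss-att : ∀ {i j k} → Triple i j k → ∀ v → miss i v ≡ not (att v i) ∧ att v j ∧ att v k
  miss-att t012 v = refl
  miss-att t120 v = refl
  miss-att t201 v = refl

  miss-not : ∀ {v} i → miss i v ≡ true → att v i ≢ true
  miss-not {v} i x with j , k , t ← others i = not-elim (proj₁ (∧-elim (not (att v i)) (trans (sym (miss-att t v)) x)))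

  miss-other : ∀ {v} i j → i ≢ j → miss i v ≡ true → att v j ≡ true
  miss-other {v} i j ne x with i₁ , i₂ , t ← others i
    with _ , y ← ∧-elim (not (att v i)) (trans (sym (miss-att t v)) x) | triple-cover t j
  ... | inj₁ refl        = contradiction refl ne
  ... | inj₂ (inj₁ refl) = proj₁ (∧-elim (att v i₁) y)
  ... | inj₂ (inj₂ refl) = proj₂ (∧-elim (att v i₁) y)

  full-att : ∀ {v} i → full v ≡ true → att v i ≡ true
  full-att {v} 0F x = proj₁ (∧-elim (att v 0F) x)
  full-att {v} 1F x = proj₁ (∧-elim (att v 1F) (proj₂ (∧-elim (att v 0F) x)))
  full-att {v} 2F x = proj₂ (∧-elim (att v 1F) (proj₂ (∧-elim (att v 0F) x)))

  miss-unique : ∀ {v i j} → miss i v ≡ true → miss j v ≡ true → i ≡ j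
  miss-unique {v} {i} {j} x y with i ≟ j
  ... | yes eq = eq
  ... | no ne  = contradiction (miss-other i j ne x) (miss-not j y)

  open Packing full miss (λ {v} {i} x y → miss-not i y (full-att i x)) miss-unique

  -- Vertices that miss different terminals are both attached to a third one, through which their
  -- colours agree; each also reaches the terminal that the other misses.
  good-joins : ∀ {W} → Good W → Joins H W
  good-joins (inj₁ (v , wv , f)) X t _ xa i j = trans (sym (eq i)) (eq j)
    where
    eq : ∀ i → X v ≡ t i
    eq i = xa v i wv (does-elim (A? H v i) (full-att i f))
  good-joins {W} (inj₂ (i , j , u , v , i≢j , wu , mu , wv , mv)) X t _ xa a c = trans (all a) (sym (all c))
    where
    eq : ∀ {l w} → W w ≡ true → miss l w ≡ true → ∀ a → l ≢ a → X w ≡ t a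
    eq {l} {w} ww mw a ne = xa w a ww (does-elim (A? H w a) (miss-other l a ne mw))
    all : ∀ a → t a ≡ X u
    all a with i ≟ a
    ... | no ne = sym (eq wu mu a ne)
    ... | yes refl with k , ik , jk ← third i j =
      trans (sym (eq wv mv i (i≢j ∘ sym))) (trans (eq wv mv k jk) (sym (eq wu mu k ik)))

  split : ∀ x y z → bit (x ∧ (y ∨ z)) ≤ bit (x ∧ y ∧ z) + (bit (not y ∧ z ∧ x) + bit (not z ∧ x ∧ y))
  split false y     z     = z≤n
  split true  true  true  = ≤-refl
  split true  true  false = ≤-refl
  split true  false true  = ≤-refl
  split true  false false = z≤n

  F : ℕ
  F = size full
  M : Fin 3 → ℕ
  M i = size (miss i)

  full-triple : ∀ {i j k} → Triple i j k → ∀ v → full v ≡ att v i ∧ att v j ∧ att v k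
  full-triple t012 v = refl
  full-triple t120 v = trans (∧-comm (att v 0F) _) (∧-assoc (att v 1F) _ _)
  full-triple t201 v = trans (sym (∧-assoc (att v 0F) _ _)) (∧-comm _ (att v 2F))

  attached : ∀ {i j k} → Triple i j k → m ≤ F + (M j + M k)
  attached {i} {j} {k} t = ≤-trans (tough i U Q (cut start (λ u v _ e → contradiction e (no-edge u v)) avoid))
                                   (size-cover pointwise)
    where
    U Q : Fin n → Bool
    U v = not (att v j) ∧ not (att v k)
    Q v = att v i ∧ (att v j ∨ att v k)
    cover : ∀ x y z → x ≡ true → (not y ∧ not z) ∨ (x ∧ (y ∨ z)) ≡ true
    cover true true  z     _ = refl
    cover true false true  _ = refl
    cover true false false _ = refl
    start : ∀ v → A H v i → U v ∨ Q v ≡ true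
    start v a = cover (att v i) (att v j) (att v k) (dec-true (A? H v i) a)
    avoid : ∀ u a → U u ≡ true → A H u a → a ≡ i
    avoid u a x h with triple-cover t a | ∧-elim (not (att u j)) x
    ... | inj₁ eq          | _     = eq
    ... | inj₂ (inj₁ refl) | y , _ = contradiction (dec-true (A? H u j) h) (not-elim y)
    ... | inj₂ (inj₂ refl) | _ , z = contradiction (dec-true (A? H u k) h) (not-elim z)
    pointwise : ∀ v → bit (Q v) ≤ bit (full v) + (bit (miss j v) + bit (miss k v))
    pointwise v rewrite full-triple t v | miss-att (rotate t) v | miss-att (rotate (rotate t)) v =
      split (att v i) (att v j) (att v k)

  -- The three cut inequalities sum to `3m ≤ 3F + 2 Σ₃ M`, which is at most twice the weight
  -- `F + F + Σ₃ M`. A weight below `2b` would, after doubling, give `3m + 2 ≤ 4b`: parity gains the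
  -- 1 in the hypothesis `4b≤`.
  total : b + b ≤ F + F + Σ₃ M
  total = ≮⇒≥ λ lt → m+1+n≰m (suc (3 * m)) {0} (≤-trans (≤-reflexive (+-comm (suc (3 * m)) 1)) (begin
    suc (suc (3 * m))                                      ≡⟨ cong (λ x → suc (suc x)) (three m) ⟩
    suc (suc (m + m + m))                                  ≤⟨ s≤s (s≤s (+-mono-≤ (+-mono-≤ (attached t012) (attached t120))
                                                                                (attached t201))) ⟩
    suc (suc (F + (M 1F + M 2F) + (F + (M 2F + M 0F)) + (F + (M 0F + M 1F))))
                                                           ≤⟨ s≤s (s≤s (m≤m+n _ F)) ⟩
    suc (suc (F + (M 1F + M 2F) + (F + (M 2F + M 0F)) + (F + (M 0F + M 1F)) + F))
                                                           ≡⟨ rearrange F (M 0F) (M 1F) (M 2F) ⟩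
    suc (F + F + Σ₃ M) + suc (F + F + Σ₃ M)                ≤⟨ +-mono-≤ lt lt ⟩
    b + b + (b + b)                                        ≡⟨ four b ⟩
    4 * b                                                  ≤⟨ 4b≤ ⟩
    suc (3 * m)                                            ∎))
    where
    open ≤-Reasoning
    three : ∀ m → 3 * m ≡ m + m + m
    three = solve-∀
    four : ∀ b → b + b + (b + b) ≡ 4 * b
    four = solve-∀
    rearrange : ∀ f x y z → suc (suc (f + (y + z) + (f + (z + x)) + (f + (x + y)) + f)) ≡
                suc (f + f + (x + y + z)) + suc (f + f + (x + y + z))
    rearrange = solve-∀

  each : ∀ i → b + M i ≤ F + Σ₃ M
  each i with j , k , t ← others i = begin
    b + M i                 ≤⟨ +-monoˡ-≤ (M i) (≤-trans b≤m (attached t)) ⟩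
    F + (M j + M k) + M i   ≡⟨ +-assoc F _ _ ⟩
    F + (M j + M k + M i)   ≡⟨ cong (F +_) (triple-Σ₃ (rotate t) M) ⟨
    F + Σ₃ M                ∎
    where open ≤-Reasoning

  packed : Packed b H
  packed with W , good , _ , disj ← pack b (λ _ → true) total each = W , good-joins ∘ good , disj

tough-packed : b ≤ m → 4 * b ≤ suc (3 * m) → (H : Net n) → Tough m H → Packed b H
tough-packed {b} {m} {n} b≤m 4b≤ H = reduce (allFin n) H (λ u _ _ → ∈-allFin u)
  where open Reduction m b (Edgeless.packed m b b≤m 4b≤)

-- Growing trees

∈-tabulate⁺ : {f : Fin n → Bool} {v : Fin n} → f v ≡ true → v ∈ tabulate f
∈-tabulate⁺ {f = f} {v} h = lookup⇒[]= v (tabulate f) (trans (lookup∘tabulate f v) h)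

∈-tabulate⁻ : {f : Fin n → Bool} {v : Fin n} → v ∈ tabulate f → f v ≡ true
∈-tabulate⁻ {f = f} {v} h = trans (sym (lookup∘tabulate f v)) ([]=⇒lookup h)

module _ {F : Fin n → Fin n → Bool} {U : Subset n} where

  walk-start : ∀ {u v} → Walk F U u v → u ∈ U
  walk-start (here u)     = u
  walk-start (step u _ _) = u

  walk-append : ∀ {u v w} → Walk F U u v → Walk F U v w → Walk F U u w
  walk-append (here _)     q = q
  walk-append (step u e p) q = step u e (walk-append p q)

  walk-reverse : (∀ u v → F u v ≡ F v u) → ∀ {u v} → Walk F U u v → Walk F U v u
  walk-reverse fs (here u)     = here u
  walk-reverse fs (step {u} {w} x e p) =
    walk-append (walk-reverse fs p) (step (walk-start p) (trans (fs w u) e) (here x))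

  walk-invariant : (V : Fin n → Set) → (∀ u v → V u → v ∈ U → F u v ≡ true → V v) →
                   ∀ {u v} → Walk F U u v → V u → V v
  walk-invariant V next (here _)     x = x
  walk-invariant V next (step _ e p) x = walk-invariant V next p (next _ _ x (walk-start p) e)

-- If the ends of each edge differ in rank and every vertex has at most one
-- neighbour of smaller rank, then a walk without immediate reversals that once
-- goes up continues to go up, so it cannot be closed.
module Acyclic (F : Fin n → Fin n → Bool) (F-sym : ∀ u v → F u v ≡ F v u) (rank : Fin n → ℕ)
  (ranked : ∀ {u v} → F u v ≡ true → rank u < rank v ⊎ rank v < rank u)
  (unique-lower : ∀ {u v w} → F u w ≡ true → F v w ≡ true → rank u < rank w → rank v < rank w → u ≡ v) where

  LastUp : Fin n → List (Fin n) → Set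
  LastUp e xs = ∃ λ l → l ∈ₗ xs × F l e ≡ true × rank l < rank e

  climb : ∀ a b zs e → rank a < rank b → F a b ≡ true → Linked F (b ∷ zs ++ [ e ]) →
          Unique (a ∷ b ∷ zs) → All (e ≢_) (b ∷ zs) → (zs ≡ [] → a ≢ e) →
          rank a < rank e × LastUp e (b ∷ zs)
  climb a b [] e up ab (be , _) _ _ a≢e with ranked be
  ... | inj₁ b<e = <-trans up b<e , b , here refl , be , b<e
  ... | inj₂ e<b = contradiction (unique-lower ab (trans (F-sym e b) be) up e<b) (a≢e refl)
  climb a b (z ∷ zs) e up ab (bz , rest) ((_ ∷ a≢z ∷ _) ∷ uniq) (e≢b ∷ e∉) _ with ranked bz
  ... | inj₂ z<b = contradiction (unique-lower ab (trans (F-sym z b) bz) up z<b) a≢z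
  ... | inj₁ b<z = let b<e , l , l∈ , last = climb b z zs e b<z bz rest uniq e∉ (λ _ → e≢b ∘ sym) in
                   <-trans up b<e , l , there l∈ , last

  -- A walk can turn from down to up but not back: it either descends all the way to `e` or arrives
  -- at `e` from below.
  descend : ∀ a b zs e → F a b ≡ true → Linked F (b ∷ zs ++ [ e ]) →
            Unique (a ∷ b ∷ zs) → All (e ≢_) (b ∷ zs) → a ≢ e →
            rank e < rank a ⊎ LastUp e (b ∷ zs)
  descend a b zs e ab rest uniq e∉ a≢e with ranked ab
  ... | inj₁ up = inj₂ (proj₂ (climb a b zs e up ab rest uniq e∉ (λ _ → a≢e)))
  descend a b [] e ab (be , _) uniq e∉ a≢e | inj₂ down with ranked be
  ... | inj₁ b<e = inj₂ (b , here refl , be , b<e)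
  ... | inj₂ e<b = inj₁ (<-trans e<b down)
  descend a b (z ∷ zs) e ab (bz , rest) (_ ∷ uniq) (e≢b ∷ e∉) a≢e | inj₂ down
    with descend b z zs e bz rest uniq e∉ (e≢b ∘ sym)
  ... | inj₁ e<b            = inj₁ (<-trans e<b down)
  ... | inj₂ (l , l∈ , last) = inj₂ (l , there l∈ , last)

  acyclic : ¬ HasCycle F
  acyclic (x , y ∷ z ∷ zs , _ , uniq@((x≢y ∷ x∉) ∷ uniq′@(y∉ ∷ _)) , xy , rest@(yz , rest′)) with ranked xy
  ... | inj₁ up   = <-irrefl refl (proj₁ (climb x y (z ∷ zs) x up xy rest uniq (x≢y ∷ x∉) λ ()))
  ... | inj₂ down with descend y z zs x yz rest′ uniq′ x∉ (x≢y ∘ sym)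
  ...   | inj₁ x<y                  = <-asym x<y down
  -- Both `l` and `y` are lower neighbours of `x`, hence equal, although the vertices of a cycle are
  -- distinct.
  ...   | inj₂ (l , l∈ , lx , l<x) =
    All.lookup y∉ l∈ (unique-lower (trans (F-sym y x) xy) lx down l<x)
  acyclic (x , [] , () , _)
  acyclic (x , y ∷ [] , s≤s () , _)

-- The depths later serve as the ranks that exclude cycles; they need only increase from parent to
-- child. Parents and depths outside `R` are arbitrary.
record Rooted (E : Fin n → Fin n → Set) (root : Fin n) : Set where
  field
    R      : Fin n → Bool
    parent : Fin n → Fin n
    depth  : Fin n → ℕ
    R-root : R root ≡ true
    up     : ∀ v → R v ≡ true → v ≢ root →
             R (parent v) ≡ true × depth (parent v) < depth v × E (parent v) v

module _ {E : Fin n → Fin n → Set} (E? : ∀ u v → Dec (E u v)) (root : Fin n) where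
  open Rooted

  Closed : Rooted E root → Set
  Closed T = ∀ u v → R T u ≡ true → E u v → R T v ≡ true

  attach : (T : Rooted E root) → ∀ {u v} → R T u ≡ true → R T v ≡ false → E u v →
           Σ[ T′ ∈ Rooted E root ] size (not ∘ R T′) < size (not ∘ R T)
  attach T {u} {v} ru ¬rv e = T′ ,
    size-strict v (λ w x → ¬-mono w x) (λ x → not-elim x (R′-new refl)) (cong not ¬rv)
    where
    R′ : Fin n → Bool
    R′ w = does (w ≟ v) ∨ R T w
    R′-new : ∀ {w} → w ≡ v → R′ w ≡ true
    R′-new {w} eq = ∨-introˡ (dec-true (w ≟ v) eq)
    R′-old : ∀ {w} → R T w ≡ true → R′ w ≡ true
    R′-old {w} = ∨-introʳ {does (w ≟ v)}
    ¬-mono : ∀ w → not (R′ w) ≡ true → not (R T w) ≡ true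
    ¬-mono w x with R T w
    ... | false = refl
    ... | true  = contradiction (∨-introʳ {does (w ≟ v)} refl) (not-elim x)
    old≢v : ∀ {w} → R T w ≡ true → w ≢ v
    old≢v rw refl = case trans (sym rw) ¬rv of λ ()
    parent′ : Fin n → Fin n
    parent′ w with w ≟ v
    ... | yes _ = u
    ... | no _  = parent T w
    depth′ : Fin n → ℕ
    depth′ w with w ≟ v
    ... | yes _ = suc (depth T u)
    ... | no _  = depth T w
    depth′-old : ∀ {w} → R T w ≡ true → depth′ w ≡ depth T w
    depth′-old {w} rw with w ≟ v
    ... | yes eq = contradiction eq (old≢v rw)
    ... | no _   = refl
    up′ : ∀ w → R′ w ≡ true → w ≢ root →
          R′ (parent′ w) ≡ true × depth′ (parent′ w) < depth′ w × E (parent′ w) w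
    up′ w rw w≢ with w ≟ v
    ... | yes refl = R′-old ru , s≤s (≤-reflexive (depth′-old ru)) , e
    ... | no _     = let rp , lt , ep = up T w rw w≢ in
                     R′-old rp , subst (_< depth T w) (sym (depth′-old rp)) lt , ep
    T′ : Rooted E root
    T′ = record { R = R′ ; parent = parent′ ; depth = depth′ ; R-root = R′-old (R-root T) ; up = up′ }

  grow : ∀ k (T : Rooted E root) → size (not ∘ R T) ≤ k → Σ[ T′ ∈ Rooted E root ] Closed T′
  grow k T le with any? (λ u → any? λ v → R T u Bool.≟ true ×-dec R T v Bool.≟ false ×-dec E? u v)
  ... | no none = T , closed
    where
    closed : Closed T
    closed u v ru e with R T v in eq
    ... | true  = refl
    ... | false = contradiction (u , v , ru , eq , e) none
  grow k T le | yes (u , v , ru , ¬rv , e) with attach T ru ¬rv e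
  grow zero    T le | yes _ | T′ , lt = contradiction (≤-trans lt le) λ ()
  grow (suc k) T le | yes _ | T′ , lt = grow k T′ (≤-pred (≤-trans lt le))

  -- Being closed and reached through parents, `R` is exactly the set of vertices reachable from
  -- `root`.
  spanning : Σ[ T ∈ Rooted E root ] Closed T
  spanning = grow _ single ≤-refl
    where
    single : Rooted E root
    single = record
      { R = λ v → does (v ≟ root) ; parent = λ v → v ; depth = λ _ → 0
      ; R-root = dec-true (root ≟ root) refl
      ; up = λ v rv v≢ → contradiction (does-elim (v ≟ root) rv) v≢ }

module TreeOf {G : Graph n} {E : Fin n → Fin n → Set} (E-adj : ∀ {u v} → E u v → adj G u v ≡ true)
              (E-sym : ∀ {u v} → E u v → E v u) {root : Fin n} (T : Rooted E root) where
  open Rooted T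

  Child : Fin n → Fin n → Set
  Child u v = R v ≡ true × v ≢ root × u ≡ parent v

  child? : ∀ u v → Dec (Child u v)
  child? u v = R v Bool.≟ true ×-dec ¬? (v ≟ root) ×-dec u ≟ parent v

  link? : ∀ u v → Dec (Child u v ⊎ Child v u)
  link? u v = child? u v ⊎-dec child? v u

  F : Fin n → Fin n → Bool
  F u v = does (link? u v)

  F-sym : ∀ u v → F u v ≡ F v u
  F-sym u v = ∨-comm (does (child? u v)) _

  child-E : ∀ {u v} → Child u v → E u v
  child-E (rv , v≢ , refl) = proj₂ (proj₂ (up _ rv v≢))

  child-depth : ∀ {u v} → Child u v → depth u < depth v
  child-depth (rv , v≢ , refl) = proj₁ (proj₂ (up _ rv v≢))

  F-E : ∀ {u v} → F u v ≡ true → E u v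
  F-E {u} {v} f with does-elim (link? u v) f
  ... | inj₁ c = child-E c
  ... | inj₂ c = E-sym (child-E c)

  F-R : ∀ {u v} → F u v ≡ true → R u ≡ true
  F-R {u} {v} f with does-elim (link? u v) f
  ... | inj₁ (rv , v≢ , refl) = proj₁ (up v rv v≢)
  ... | inj₂ (ru , _)         = ru

  to-root : ∀ k v → depth v < k → R v ≡ true → Walk F (tabulate R) v root
  to-root (suc k) v lt rv with v ≟ root
  ... | yes refl = here (∈-tabulate⁺ rv)
  ... | no v≢    = let rp , d , _ = up v rv v≢ in
    step (∈-tabulate⁺ rv) (dec-true (link? v (parent v)) (inj₂ (rv , v≢ , refl)))
         (to-root k (parent v) (≤-trans d (≤-pred lt)) rp)

  ranked : ∀ {u v} → F u v ≡ true → depth u < depth v ⊎ depth v < depth u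
  ranked {u} {v} f with does-elim (link? u v) f
  ... | inj₁ c = inj₁ (child-depth c)
  ... | inj₂ c = inj₂ (child-depth c)

  lower-parent : ∀ {u w} → F u w ≡ true → depth u < depth w → u ≡ parent w
  lower-parent {u} {w} f lt with does-elim (link? u w) f
  ... | inj₁ (_ , _ , eq) = eq
  ... | inj₂ c            = contradiction lt (<-asym (child-depth c))

  F-acyclic : ¬ HasCycle F
  F-acyclic = Acyclic.acyclic F F-sym depth ranked
    (λ f g u<w v<w → trans (lower-parent f u<w) (sym (lower-parent g v<w)))

  tree : Subgraph G
  tree = record
    { verts = tabulate R ; edges = F ; esym = F-sym
    ; eInG = λ u v f → E-adj (F-E f) ; eInV = λ u v f → ∈-tabulate⁺ (F-R {u} {v} f) }

  isTree : IsTree tree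
  isTree = (λ u v ru rv → walk-append (to-root _ u ≤-refl (∈-tabulate⁻ ru))
                            (walk-reverse F-sym (to-root _ v ≤-refl (∈-tabulate⁻ rv)))) , F-acyclic

-- The net of three terminals in a graph

separator-bound : {G : Graph n} → (∀ Q → Separates G Q → m ≤ ∣ Q ∣) → (f : Fin n → Bool) →
                  ¬ ConnectedOn (adj G) (tabulate (not ∘ f)) ⊎ size (not ∘ f) ≤ 1 → m ≤ size f
separator-bound {m = m} {G} bound f h =
  subst (m ≤_) (∣tabulate∣ f) (bound (tabulate f)
    (subst (λ P → ¬ ConnectedOn (adj G) P ⊎ ∣ P ∣ ≤ 1) (tabulate-∘ not f)
      ([ inj₁ , (λ le → inj₂ (subst (_≤ 1) (sym (∣tabulate∣ (not ∘ f))) le)) ]′ h)))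

disconnects : {F : Fin n → Fin n → Bool} {f : Fin n → Bool} (V : Fin n → Set) →
              (∀ u v → V u → f v ≡ false → F u v ≡ true → V v) →
              ∀ {x y} → f x ≡ false → f y ≡ false → V x → ¬ V y → ¬ ConnectedOn F (tabulate (not ∘ f))
disconnects V next {x} {y} fx fy vx vy conn = vy
  (walk-invariant V (λ u v vu v∈ → next u v vu (not-true (∈-tabulate⁻ v∈)))
    (conn x y (∈-tabulate⁺ (cong not fx)) (∈-tabulate⁺ (cong not fy))) vx)
  where
  not-true : ∀ {z} → not z ≡ true → z ≡ false
  not-true {false} _ = refl

Diff : (i j k : Fin 3) → Set
Diff i j k = i ≢ j × i ≢ k × j ≢ k

diff? : ∀ i j k → Dec (Diff i j k)
diff? i j k = ¬? (i ≟ j) ×-dec ¬? (i ≟ k) ×-dec ¬? (j ≟ k)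

diff-unique : ∀ i j k l → Diff i j k → Diff i l k → j ≡ l
diff-unique = from-yes (all? {3} λ i → all? {3} λ j → all? {3} λ k → all? {3} λ l →
  diff? i j k →-dec diff? i l k →-dec j ≟ l)

-- For the subdividing vertex stored at terminal `j`, this picks one end of its edge, whose colour
-- it will receive.
next : Fin 3 → Fin 3
next 0F = 1F
next 1F = 2F
next 2F = 0F

diff-next : ∀ i j k → Diff i j k → next j ≡ i ⊎ next j ≡ k
diff-next = from-yes (all? {3} λ i → all? {3} λ j → all? {3} λ k →
  diff? i j k →-dec (next j ≟ i ⊎-dec next j ≟ k))

triple-diff : ∀ {i j k} → Triple i j k → Diff i j k
triple-diff t = triple-≢ t , triple-≢′ t , triple-≢″ t

module _ (p q : Fin n) where
  swap-first : transpose p q ⟨$⟩ʳ p ≡ q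
  swap-first rewrite dec-true (p ≟ p) refl = refl

  swap-second : p ≢ q → transpose p q ⟨$⟩ʳ q ≡ p
  swap-second ne rewrite dec-false (q ≟ p) (ne ∘ sym) | dec-true (q ≟ q) refl = refl

  swap-other : ∀ {v} → v ≢ p → v ≢ q → transpose p q ⟨$⟩ʳ v ≡ v
  swap-other {v} np nq rewrite dec-false (v ≟ p) np | dec-false (v ≟ q) nq = refl

module Terminals (G : Graph n) (s : Fin 3 → Fin n) (s-injective : ∀ {i j} → s i ≡ s j → i ≡ j) where

  Adj : Fin n → Fin n → Set
  Adj u v = adj G u v ≡ true

  Adj-sym : ∀ {u v} → Adj u v → Adj v u
  Adj-sym {u} {v} e = trans (adj-sym G v u) e

  Adj-irrefl : ∀ {u} → ¬ Adj u u
  Adj-irrefl {u} e = case trans (sym e) (irrefl G u) of λ ()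

  Terminal : Fin n → Set
  Terminal v = ∃ λ i → s i ≡ v

  abstract
    terminal? : ∀ v → Dec (Terminal v)
    terminal? v = any? λ i → s i ≟ v

  -- The edge between two terminals is subdivided; the subdividing vertex is
  -- represented by the third terminal, which is otherwise unused in the net.
  net : Net n
  net = record
    { E     = λ u v → Adj u v × ¬ Terminal u × ¬ Terminal v
    ; A     = λ v i → ¬ Terminal v × Adj v (s i) ⊎
                      ∃ λ j → ∃ λ k → s j ≡ v × Diff i j k × Adj (s i) (s k)
    ; E?    = λ u v → adj G u v Bool.≟ true ×-dec ¬? (terminal? u) ×-dec ¬? (terminal? v)
    ; A?    = λ v i → (¬? (terminal? v) ×-dec adj G v (s i) Bool.≟ true) ⊎-dec
                      any? λ j → any? λ k → s j ≟ v ×-dec diff? i j k ×-dec adj G (s i) (s k) Bool.≟ true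
    ; E-sym = λ (e , nu , nv) → Adj-sym e , nv , nu
    }

  module CutBound (bound : ∀ Q → Separates G Q → m ≤ ∣ Q ∣) {i : Fin 3} {U Q : Fin n → Bool}
                  (c : IsCut net i U Q) (disjoint : ∀ v → U v ≡ true → Q v ≡ false) where
    open IsCut c
    x : Fin n
    x = s i

    Side : Fin n → Set
    Side v = U v ≡ true × ¬ Terminal v

    -- A terminal adjacent to `x` enters the separator in exchange for the subdividing vertex of its
    -- edge to `x`.
    Sep : Fin n → Bool
    Sep v = if does (terminal? v) then adj G x v else Q v

    sep-terminal : ∀ {v} → Terminal v → Sep v ≡ adj G x v
    sep-terminal {v} tv with terminal? v
    ... | yes _ = refl
    ... | no nt = contradiction tv nt

    -- A subdividing vertex is attached to both ends of its edge, so it cannot lie on the side of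
    -- one of them.
    edge-node : ∀ {j k} → Diff i j k → Adj x (s k) → Q (s j) ≡ true
    edge-node {j} {k} d@(i≢j , i≢k , j≢k) e
      with ∨-elim {U (s j)} (start (s j) (inj₂ (j , k , refl , d , e)))
    ... | inj₂ q = q
    ... | inj₁ u = contradiction
      (avoid (s j) k u (inj₂ (j , i , refl , (j≢k ∘ sym , i≢k ∘ sym , i≢j ∘ sym) , Adj-sym e)))
      (i≢k ∘ sym)

    side-step : ∀ {u v} → Side u → ¬ Terminal v → Adj u v → U v ≡ true ⊎ Q v ≡ true
    side-step {u} {v} (uu , nu) nv e = ∨-elim (closed u v uu (e , nu , nv))

    side-terminal : ∀ {u l} → Side u → Adj u (s l) → l ≡ i
    side-terminal {u} {l} (uu , nu) e = avoid u l uu (inj₁ (nu , e))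

    -- The edge from `x` to one of the other terminals has its subdividing vertex stored at the
    -- remaining one, so transposing these two terminals carries `Sep` into `Q`.
    sep-size : size Sep ≤ size Q
    sep-size with j , k , t ← others i =
      subst (size Sep ≤_) (sym (size-permute Q (s j) (s k))) (size-mono swapped)
      where
      swapped : ∀ v → Sep v ≡ true → Q (transpose (s j) (s k) ⟨$⟩ʳ v) ≡ true
      swapped v q with terminal? v
      swapped v q | yes (l , refl) with triple-cover t l
      ... | inj₁ refl = contradiction q Adj-irrefl
      ... | inj₂ (inj₁ refl) = subst (λ w → Q w ≡ true) (sym (swap-first (s j) (s k)))
        (edge-node (triple-≢′ t , triple-≢ t , triple-≢″ t ∘ sym) q)
      ... | inj₂ (inj₂ refl) = subst (λ w → Q w ≡ true) (sym (swap-second (s j) (s k) (triple-≢″ t ∘ s-injective)))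
        (edge-node (triple-diff t) q)
      swapped v q | no nt = subst (λ w → Q w ≡ true)
        (sym (swap-other (s j) (s k) (λ { refl → nt (j , refl) }) (λ { refl → nt (k , refl) }))) q

    Outside : Fin n → Set
    Outside v = v ≢ x × ¬ Side v × Sep v ≡ false

    outside? : ∀ v → Dec (Outside v)
    outside? v = ¬? (v ≟ x) ×-dec ¬? (U v Bool.≟ true ×-dec ¬? (terminal? v)) ×-dec Sep v Bool.≟ false

    far-vertex : (∃ λ v → Outside v) → m ≤ size Sep
    far-vertex (v , v≢x , ¬side , ¬sep) = separator-bound {G = G} bound Sep (inj₁
      (disconnects (λ u → u ≡ x ⊎ Side u) step′ (trans (sep-terminal (i , refl)) (irrefl G x)) ¬sep
        (inj₁ refl) [ v≢x , ¬side ]′))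
      where
      step′ : ∀ u w → u ≡ x ⊎ Side u → Sep w ≡ false → Adj u w → w ≡ x ⊎ Side w
      step′ u w (inj₁ refl) ¬q e with terminal? w
      ... | yes _ = case trans (sym e) ¬q of λ ()
      ... | no nw with ∨-elim {U w} (start w (inj₁ (nw , Adj-sym e)))
      ...   | inj₁ uw = inj₂ (uw , nw)
      ...   | inj₂ qw = case trans (sym qw) ¬q of λ ()
      step′ u w (inj₂ side) ¬q e with terminal? w
      ... | yes (l , refl) = inj₁ (cong s (side-terminal side e))
      ... | no nw with side-step side nw e
      ...   | inj₁ uw = inj₂ (uw , nw)
      ...   | inj₂ qw = case trans (sym qw) ¬q of λ ()

    -- If every vertex is on the side of x or in Sep, then x is adjacent to both
    -- other terminals, and replacing these two by x gives a separator unless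
    -- the side of x is trivial.
    no-far-vertex : ¬ (∃ λ v → Outside v) → m ≤ size Q
    no-far-vertex none with j , k , t ← others i | any? (λ v → U v Bool.≟ true ×-dec ¬? (terminal? v))
    -- Every vertex but `x` is in `Sep`, so its removal leaves a trivial graph.
    ... | no trivial = ≤-trans (separator-bound {G = G} bound Sep (inj₂
        (≤-trans (size-mono only-x) (≤-reflexive (size-singleton x))))) sep-size
      where
      only-x : ∀ v → not (Sep v) ≡ true → does (v ≟ x) ≡ true
      only-x v ¬q with v ≟ x
      ... | yes _ = refl
      ... | no ne with Sep v in eq
      ...   | false = contradiction (v , ne , (λ side → trivial (v , side)) , eq) none
      only-x v () | no ne | true
    ... | yes (u , side) = ≤-trans (separator-bound {G = G} bound Q⁰ (inj₁
        (disconnects Side step′ u∉ y∉ side (λ (_ , ny) → ny (j , refl))))) Q⁰-size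
      where
      neighbour : ∀ {l} → l ≢ i → Adj x (s l)
      neighbour {l} l≢i with true-or-false (adj G x (s l))
      ... | inj₁ e = e
      ... | inj₂ ¬e = contradiction
        (s l , l≢i ∘ s-injective , (λ (_ , nt) → nt (l , refl)) , trans (sep-terminal (l , refl)) ¬e) none
      Q′ Q⁰ : Fin n → Bool
      Q′ v = not (does (terminal? v)) ∧ Q v
      Q⁰ v = Q′ v ∨ does (v ≟ x)
      Q⁰-false : ∀ {v} → v ≢ x → Q′ v ≡ false → Q⁰ v ≡ false
      Q⁰-false {v} ne q = cong₂ _∨_ q (dec-false (v ≟ x) ne)
      u∉ : Q⁰ u ≡ false
      u∉ = Q⁰-false (λ { refl → proj₂ side (i , refl) })
        (cong₂ _∧_ (cong not (dec-false (terminal? u) (proj₂ side))) (disjoint u (proj₁ side)))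
      y∉ : Q⁰ (s j) ≡ false
      y∉ = Q⁰-false (triple-≢ t ∘ sym ∘ s-injective)
        (cong (λ z → not z ∧ Q (s j)) (dec-true (terminal? (s j)) (j , refl)))
      step′ : ∀ u w → Side u → Q⁰ w ≡ false → Adj u w → Side w
      step′ u w su ¬q e with terminal? w
      ... | yes (l , refl) with refl ← side-terminal su e =
        case trans (sym (dec-true (x ≟ x) refl)) ¬q of λ ()
      step′ u w su ¬q e | no nw with side-step su nw e
      ... | inj₁ uw = uw , nw
      ... | inj₂ qw rewrite qw = case ¬q of λ ()
      -- `Q` contains the subdividing vertex stored at `s j`; dropping it makes room for `x`.
      Q⁰-size : size Q⁰ ≤ size Q
      Q⁰-size = ≤-trans (size-insert x λ v ne q →
          [ (λ y → y) , (λ y → contradiction (does-elim (v ≟ x) y) ne) ]′ (∨-elim {Q′ v} q))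
        (size-strict (s j) (λ v q → proj₂ (∧-elim (not (does (terminal? v))) q))
          (λ q → not-elim (proj₁ (∧-elim (not (does (terminal? (s j)))) q))
                          (dec-true (terminal? (s j)) (j , refl)))
          (edge-node (triple-diff t) (neighbour (triple-≢′ t ∘ sym))))

    cut-size : m ≤ size Q
    cut-size with any? outside?
    ... | yes far = ≤-trans (far-vertex far) sep-size
    ... | no none = no-far-vertex none

  net-tough : (∀ Q → Separates G Q → m ≤ ∣ Q ∣) → Tough m net
  net-tough bound i U Q c = CutBound.cut-size bound (isCut-shrink c) disjoint
    where
    disjoint : ∀ v → U v ∧ not (Q v) ≡ true → Q v ≡ false
    disjoint v x with true-or-false (Q v)
    ... | inj₂ q = q
    ... | inj₁ q = contradiction q (not-elim (proj₂ (∧-elim (U v) x)))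

  module Trees (pack : Packed b net) where
    W : Fin b → Fin n → Bool
    W = proj₁ pack

    Owned : Fin b → Fin n → Set
    Owned l v = Terminal v ⊎ W l v ≡ true

    owned? : ∀ l v → Dec (Owned l v)
    owned? l v = terminal? v ⊎-dec W l v Bool.≟ true

    -- All bundles share the terminals, but at a terminal `W` speaks of the subdividing vertex
    -- stored there. So an edge between terminals is available only to the bundle that holds its
    -- subdividing vertex.
    Edge : Fin b → Fin n → Fin n → Set
    Edge l u v = Adj u v × Owned l u × Owned l v ×
                 (∀ i j k → Diff i j k → s i ≡ u → s k ≡ v → W l (s j) ≡ true)

    abstract
      edge? : ∀ l u v → Dec (Edge l u v)
      edge? l u v = adj G u v Bool.≟ true ×-dec owned? l u ×-dec owned? l v ×-dec
        all? λ i → all? λ j → all? λ k → diff? i j k →-dec s i ≟ u →-dec s k ≟ v →-dec W l (s j) Bool.≟ true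

    edge-sym : ∀ {l u v} → Edge l u v → Edge l v u
    edge-sym (e , ou , ov , h) = Adj-sym e , ov , ou ,
      λ i j k (i≢j , i≢k , j≢k) p q → h k j i (j≢k ∘ sym , i≢k ∘ sym , i≢j ∘ sym) q p

    abstract
      grown : ∀ l → Σ[ T ∈ Rooted (Edge l) (s 0F) ] Closed (edge? l) (s 0F) T
      grown l = spanning (edge? l) (s 0F)

    module T (l : Fin b) where
      open Rooted (proj₁ (grown l)) public
      open TreeOf {G = G} proj₁ edge-sym (proj₁ (grown l)) public

      same : ∀ {u v} → Edge l u v → R u ≡ R v
      same {u} {v} e with R u in eu | R v in ev
      ... | true  | true  = refl
      ... | false | false = refl
      ... | true  | false = trans (sym (proj₂ (grown l) u v eu e)) ev
      ... | false | true  = trans (sym eu) (proj₂ (grown l) v u ev (edge-sym e))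

      -- `Joins` is applied to the colouring by membership in the component of `s 0F`, so all
      -- terminals get the colour of the root.
      spans : ∀ v → Terminal v → R v ≡ true
      spans _ (i , refl) = trans (proj₁ (proj₂ pack) l X (R ∘ s) inner attached′ i 0F) R-root
        where
        X : Fin n → Bool
        X v with terminal? v
        ... | yes (j , _) = R (s (next j))
        ... | no _        = R v
        X-other : ∀ {v} → ¬ Terminal v → X v ≡ R v
        X-other {v} nt with terminal? v
        ... | yes tv = contradiction tv nt
        ... | no _   = refl
        X-terminal : ∀ j → X (s j) ≡ R (s (next j))
        X-terminal j with terminal? (s j)
        ... | yes (k , eq) = cong (R ∘ s ∘ next) (s-injective eq)
        ... | no nt        = contradiction (j , refl) nt
        inner : ∀ u v → W l u ≡ true → W l v ≡ true → E net u v → X u ≡ X v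
        inner u v wu wv (e , nu , nv) = trans (X-other nu) (trans
          (same (e , inj₂ wu , inj₂ wv , λ i j k _ p _ → contradiction (i , p) nu)) (sym (X-other nv)))
        attached′ : ∀ v i → W l v ≡ true → A net v i → X v ≡ R (s i)
        attached′ v i wv (inj₁ (nv , e)) = trans (X-other nv)
          (same (e , inj₂ wv , inj₁ (i , refl) , λ i j k _ p _ → contradiction (i , p) nv))
        attached′ _ i wv (inj₂ (j , k , refl , d , e)) = trans (X-terminal j)
          ([ cong (R ∘ s) , (λ eq → trans (cong (R ∘ s) eq) (sym ends)) ]′ (diff-next i j k d))
          where
          ends : R (s i) ≡ R (s k)
          ends = same (e , inj₁ (i , refl) , inj₁ (k , refl) , λ a c f d′ p q →
            node (s-injective p) (s-injective q) d′)
            where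
            node : ∀ {a c f} → a ≡ i → f ≡ k → Diff a c f → W l (s c) ≡ true
            node {c = c} refl refl d′ = subst (λ z → W l (s z) ≡ true) (diff-unique i j k c d d′) wv

      R-owned : ∀ v → R v ≡ true → Owned l v
      R-owned v rv with v ≟ s 0F
      ... | yes refl = inj₁ (0F , refl)
      ... | no ne    = proj₁ (proj₂ (proj₂ (proj₂ (proj₂ (up v rv ne)))))

    disjoint : Disjoint W
    disjoint = proj₂ (proj₂ pack)

    owned-both : ∀ {l l′ v} → l ≢ l′ → Owned l v → Owned l′ v → Terminal v
    owned-both ne (inj₁ tv) _         = tv
    owned-both ne (inj₂ _)  (inj₁ tv) = tv
    owned-both ne (inj₂ w)  (inj₂ w′) = contradiction (disjoint _ _ _ w w′) ne

    -- Both ends of a shared edge are terminals, so both bundles would hold its subdividing vertex.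
    edge-unique : ∀ {l l′ u v} → l ≢ l′ → Edge l u v → Edge l′ u v → ∀ {A : Set} → A
    edge-unique ne (e , ou , ov , h) (_ , ou′ , ov′ , h′)
      with i , refl ← owned-both ne ou ou′ | k , refl ← owned-both ne ov ov′
      with third i k
    ... | j , i≢j , k≢j = contradiction
      (disjoint _ _ _ (h i j k d refl refl) (h′ i j k d refl refl)) ne
      where
      d : Diff i j k
      d = i≢j , (λ { refl → Adj-irrefl e }) , k≢j ∘ sym

    trees : ∀ {S} → (∀ i → s i ∈ S) → (∀ v → v ∈ S → Terminal v) → HasTrees G S b
    trees s∈ ∈s = T.tree , T.isTree
      , (λ l v v∈ → ∈-tabulate⁺ (T.spans l v (∈s v v∈)))
      , (λ l l′ ne v v∈ v∈′ → subst (_∈ _)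
          (proj₂ (owned-both ne (T.R-owned l v (∈-tabulate⁻ v∈)) (T.R-owned l′ v (∈-tabulate⁻ v∈′)))) (s∈ _))
      , λ l l′ ne u v f → edge-disjoint ne f (true-or-false (T.F l′ u v))
      where
      edge-disjoint : ∀ {l l′ u v} → l ≢ l′ → T.F l u v ≡ true →
                      T.F l′ u v ≡ true ⊎ T.F l′ u v ≡ false → T.F l′ u v ≡ false
      edge-disjoint             ne f (inj₂ ¬g) = ¬g
      edge-disjoint {l} {l′} ne f (inj₁ g)  = edge-unique ne (T.F-E l f) (T.F-E l′ g)

enumerate : (S : Subset n) → Σ[ f ∈ (Fin ∣ S ∣ → Fin n) ]
            (∀ {i j} → f i ≡ f j → i ≡ j) × (∀ i → f i ∈ S) × (∀ v → v ∈ S → ∃ λ i → f i ≡ v)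
enumerate [] = (λ ()) , (λ {}) , (λ ()) , λ ()
enumerate (outside ∷ S) with f , inj , f∈ , ∈f ← enumerate S =
  suc ∘ f , inj ∘ suc-injective , there ∘ f∈ ,
  λ { (suc v) (there v∈) → let i , eq = ∈f v v∈ in i , cong suc eq }
enumerate {suc n} (inside ∷ S) with f , inj , f∈ , ∈f ← enumerate S = g , g-inj , g∈ , ∈g
  where
  g : Fin (suc ∣ S ∣) → Fin (suc n)
  g zero    = zero
  g (suc i) = suc (f i)
  g-inj : ∀ {i j} → g i ≡ g j → i ≡ j
  g-inj {zero}  {zero}  _  = refl
  g-inj {suc i} {suc j} eq = cong suc (inj (suc-injective eq))
  g∈ : ∀ i → g i ∈ inside ∷ S
  g∈ zero    = here
  g∈ (suc i) = there (f∈ i)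
  ∈g : ∀ v → v ∈ inside ∷ S → ∃ λ i → g i ≡ v
  ∈g zero    _          = zero , refl
  ∈g (suc v) (there v∈) = let i , eq = ∈f v v∈ in suc i , cong suc eq

kappa3-bound : (G : Graph n) → IsConnectivity G m → b ≤ m → 4 * b ≤ suc (3 * m) → Kappa3AtLeast G b
kappa3-bound G (_ , bound) b≤m 4b≤ S ∣S∣≡3 with enumerate S
... | f , inj , f∈ , ∈f rewrite ∣S∣≡3 = Trees.trees (tough-packed b≤m 4b≤ net (net-tough bound)) f∈ ∈f
  where open Terminals G f inj

-- Extremal graphs

∁-tabulate : (Q : Subset n) → ∁ Q ≡ tabulate (not ∘ lookup Q)
∁-tabulate Q = trans (cong ∁ (sym (tabulate∘lookup Q))) (sym (tabulate-∘ not (lookup Q)))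

first-edge : {F : Fin n → Fin n → Bool} {U : Subset n} {x y : Fin n} →
             Walk F U x y → x ≢ y → ∃ λ w → F x w ≡ true
first-edge (here _)     x≢y = contradiction refl x≢y
first-edge (step _ e _) _   = _ , e

-- An independent set of three terminals and a clique in which v is adjacent to
-- all terminals but g v.
module Extremal {M : ℕ} (g : Fin M → Fin 3) where

  term : Fin 3 → Fin (3 + M)
  term i = i ↑ˡ M

  clique : Fin M → Fin (3 + M)
  clique v = 3 ↑ʳ v

  view : ∀ x → (∃ λ i → x ≡ term i) ⊎ (∃ λ v → x ≡ clique v)
  view 0F                  = inj₁ (0F , refl)
  view 1F                  = inj₁ (1F , refl)
  view 2F                  = inj₁ (2F , refl)
  view (suc (suc (suc v))) = inj₂ (v , refl)

  misses : Fin 3 → Fin M → Bool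
  misses i v = does (g v ≟ i)

  adjacent : Fin 3 ⊎ Fin M → Fin 3 ⊎ Fin M → Bool
  adjacent (inj₁ _) (inj₁ _) = false
  adjacent (inj₁ i) (inj₂ v) = not (misses i v)
  adjacent (inj₂ v) (inj₁ i) = not (misses i v)
  adjacent (inj₂ u) (inj₂ v) = not (does (u ≟ v))

  adjacent-sym : ∀ x y → adjacent x y ≡ adjacent y x
  adjacent-sym (inj₁ _) (inj₁ _) = refl
  adjacent-sym (inj₁ _) (inj₂ _) = refl
  adjacent-sym (inj₂ _) (inj₁ _) = refl
  adjacent-sym (inj₂ u) (inj₂ v) with u ≟ v
  ... | yes refl = cong not (sym (dec-true (u ≟ u) refl))
  ... | no u≢v   = cong not (sym (dec-false (v ≟ u) (u≢v ∘ sym)))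

  adjacent-irrefl : ∀ x → adjacent x x ≡ false
  adjacent-irrefl (inj₁ _) = refl
  adjacent-irrefl (inj₂ v) = cong not (dec-true (v ≟ v) refl)

  G : Graph (3 + M)
  G = record
    { adj    = λ u v → adjacent (splitAt 3 u) (splitAt 3 v)
    ; sym    = λ u v → adjacent-sym (splitAt 3 u) (splitAt 3 v)
    ; irrefl = λ u → adjacent-irrefl (splitAt 3 u)
    }

  term-term : ∀ i j → adj G (term i) (term j) ≡ false
  term-term i j = cong₂ adjacent (splitAt-↑ˡ 3 i M) (splitAt-↑ˡ 3 j M)

  term-clique : ∀ i v → adj G (term i) (clique v) ≡ not (misses i v)
  term-clique i v = cong (λ x → adjacent x (inj₂ v)) (splitAt-↑ˡ 3 i M)

  clique-neighbour : ∀ {i x} → adj G (term i) x ≡ true → ∃ λ v → x ≡ clique v × g v ≢ i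
  clique-neighbour {i} {x} e with view x
  ... | inj₁ (j , refl) = case trans (sym e) (term-term i j) of λ ()
  ... | inj₂ (v , refl) = v , refl , λ eq →
    not-elim (trans (sym (term-clique i v)) e) (dec-true (g v ≟ i) eq)

  -- `size (not ∘ misses i)` is the degree of terminal `i`. A set below all three degrees spares a
  -- neighbour of every terminal, and what remains of the clique is connected.
  module Outside (q : Fin (3 + M) → Bool) (q-small : ∀ i → size q < size (not ∘ misses i)) where
    U : Subset (3 + M)
    U = tabulate (not ∘ q)

    _∈U : Fin (3 + M) → Set
    x ∈U = x ∈ U

    clique-walk : ∀ u v → clique u ∈U → clique v ∈U → Walk (adj G) U (clique u) (clique v)
    clique-walk u v u∈ v∈ with u ≟ v
    ... | yes refl = here u∈
    ... | no u≢v   = step u∈ (cong not (dec-false (u ≟ v) u≢v)) (here v∈)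

    free-neighbour : ∀ i → ∃ λ v → misses i v ≡ false × q (clique v) ≡ false
    free-neighbour i with any? (λ v → misses i v Bool.≟ false ×-dec q (clique v) Bool.≟ false)
    ... | yes found = found
    ... | no none   = contradiction (≤-<-trans (≤-trans (size-mono covered) clique-size) (q-small i)) (<-irrefl refl)
      where
      covered : ∀ v → not (misses i v) ≡ true → q (clique v) ≡ true
      covered v x with true-or-false (q (clique v)) | true-or-false (misses i v)
      ... | inj₁ y | _      = y
      ... | inj₂ _ | inj₁ z = contradiction z (not-elim x)
      ... | inj₂ y | inj₂ z = contradiction (v , z , y) none
      clique-size : size (q ∘ clique) ≤ size q
      clique-size = ≤-trans (m≤n+m _ (size (q ∘ term))) (≤-reflexive (sym (size-++ 3 q)))

    to-clique : ∀ x → x ∈U → ∃ λ v → Walk (adj G) U x (clique v) × clique v ∈U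
    to-clique x x∈ with view x
    ... | inj₂ (v , refl) = v , here x∈ , x∈
    ... | inj₁ (i , refl) = let v , mv , qv = free-neighbour i
                                v∈ = ∈-tabulate⁺ {f = not ∘ q} (cong not qv) in
      v , step x∈ (trans (term-clique i v) (cong not mv)) (here v∈) , v∈

    connected : ConnectedOn (adj G) U
    connected x y x∈ y∈ = let u , p , u∈ = to-clique x x∈ ; v , p′ , v∈ = to-clique y y∈ in
      walk-append p (walk-append (clique-walk u v u∈ v∈) (walk-reverse (adj-sym G) p′))

  connectedGraph : (∀ i → 0 < size (not ∘ misses i)) → ConnectedGraph G
  connectedGraph pos = (term 0F , tt) , subst (ConnectedOn (adj G)) (full (3 + M))
    (Outside.connected (λ _ → false) λ i → subst (_< size (not ∘ misses i)) (sym (size-empty {3 + M})) (pos i))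
    where
    full : ∀ n → tabulate {n = n} (λ _ → true) ≡ ⊤
    full zero    = refl
    full (suc n) = cong (true ∷_) (full n)

  -- The neighbourhood of the first terminal isolates it from the other two. Having `m ≤ M` ensures
  -- that a smaller set leaves at least three vertices, hence no trivial graph.
  isConnectivity : (∀ i → m ≤ size (not ∘ misses i)) → size (not ∘ misses 0F) ≡ m → m ≤ M → IsConnectivity G m
  isConnectivity {m} degrees degree₀ m≤M = (tabulate N , trans (∣tabulate∣ N) N-size , inj₁ isolated) , bound
    where
    N : Fin (3 + M) → Bool
    N = adj G (term 0F)
    N-size : size N ≡ m
    N-size = trans (size-++ 3 N) (trans (cong₂ _+_
      (trans (size-cong (term-term 0F)) (size-empty {3})) refl) degree₀)
    isolated : ¬ ConnectedOn (adj G) (∁ (tabulate N))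
    isolated = subst (λ P → ¬ ConnectedOn (adj G) P) (tabulate-∘ not N)
      (disconnects (_≡ term 0F) (λ { u v refl ¬e e → case trans (sym e) ¬e of λ () })
        {term 0F} {term 1F} refl refl refl λ ())
    bound : ∀ Q → Separates G Q → m ≤ ∣ Q ∣
    bound Q sep = ≮⇒≥ (λ lt → impossible lt sep)
      where
      impossible : ∣ Q ∣ < m → ¬ Separates G Q
      impossible lt (inj₁ disconnected) = disconnected (subst (ConnectedOn (adj G)) (sym (∁-tabulate Q))
        (Outside.connected (lookup Q) λ i → ≤-trans
          (subst (_< m) (trans (cong ∣_∣ (sym (tabulate∘lookup Q))) (∣tabulate∣ (lookup Q))) lt) (degrees i)))
      impossible lt (inj₂ small) =
        contradiction (≤-trans big (subst (_≤ 1) (∣∁p∣≡n∸∣p∣ Q) small)) λ { (s≤s ()) }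
        where
        big : 3 ≤ 3 + M ∸ ∣ Q ∣
        big = ≤-trans (m≤m+n 3 (M ∸ ∣ Q ∣)) (≤-reflexive (sym (+-∸-assoc 3 (≤-trans (<⇒≤ lt) m≤M))))

  S : Subset (3 + M)
  S = inside ∷ inside ∷ inside ∷ ⊥

  ∣S∣≡3 : ∣ S ∣ ≡ 3
  ∣S∣≡3 = cong (3 +_) (∣⊥∣≡0 M)

  term∈S : ∀ i → term i ∈ S
  term∈S 0F = here
  term∈S 1F = there here
  term∈S 2F = there (there here)

  clique∉S : ∀ {v} → ¬ clique v ∈ S
  clique∉S (there (there (there v∈))) = ∉⊥ v∈

  -- A tree connecting the terminals leaves each of them through the clique, and
  -- no clique vertex serves all of them: it uses at least two clique vertices.
  module Count {ℓ} (trees : HasTrees G S ℓ) where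
    T : Fin ℓ → Subgraph G
    T = proj₁ trees

    leave : ∀ l i → ∃ λ v → clique v ∈ verts (T l) × g v ≢ i
    leave l i with first-edge (proj₁ (proj₁ (proj₂ trees) l) (term i) (term (next i))
                                     (spans i) (spans (next i))) (≢-next i)
      where
      spans : ∀ i → term i ∈ verts (T l)
      spans i = proj₁ (proj₂ (proj₂ trees)) l (term i) (term∈S i)
      ≢-next : ∀ i → term i ≢ term (next i)
      ≢-next 0F ()
      ≢-next 1F ()
      ≢-next 2F ()
    ... | w , f with v , refl , gv ← clique-neighbour {i} {w} (eInG (T l) _ _ f) =
      v , eInV (T l) _ _ (trans (esym (T l) _ _) f) , gv

    pick : Fin ℓ → Fin 2 → Fin M
    pick l 0F = proj₁ (leave l 0F)
    -- Leaving from the terminal that the first vertex misses forces a second vertex.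
    pick l 1F = proj₁ (leave l (g (pick l 0F)))

    pick∈ : ∀ l c → clique (pick l c) ∈ verts (T l)
    pick∈ l 0F = proj₁ (proj₂ (leave l 0F))
    pick∈ l 1F = proj₁ (proj₂ (leave l (g (pick l 0F))))

    pick-≢ : ∀ l → pick l 0F ≢ pick l 1F
    pick-≢ l eq = proj₂ (proj₂ (leave l (g (pick l 0F)))) (cong g (sym eq))

    pick-injective : ∀ {l l′} c c′ → pick l c ≡ pick l′ c′ → l ≡ l′ × c ≡ c′
    pick-injective {l} {l′} c c′ eq with l ≟ l′
    ... | no ne    = contradiction (proj₁ (proj₂ (proj₂ (proj₂ trees))) l l′ ne (clique (pick l c)) (pick∈ l c)
                       (subst (λ v → clique v ∈ verts (T l′)) (sym eq) (pick∈ l′ c′))) clique∉S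
    ... | yes refl = refl , same c c′ eq
      where
      same : ∀ c c′ → pick l c ≡ pick l c′ → c ≡ c′
      same 0F 0F _  = refl
      same 0F 1F eq = contradiction eq (pick-≢ l)
      same 1F 0F eq = contradiction (sym eq) (pick-≢ l)
      same 1F 1F _  = refl

    few : ℓ * 2 ≤ M
    few = injective⇒≤ {f = f} λ {x} {y} eq →
      let p , q = pick-injective (proj₂ (remQuot {ℓ} 2 x)) (proj₂ (remQuot {ℓ} 2 y)) eq in
      trans (sym (combine-remQuot {ℓ} 2 x)) (trans (cong₂ combine p q) (combine-remQuot {ℓ} 2 y))
      where
      f : Fin (ℓ * 2) → Fin M
      f x = pick (proj₁ (remQuot {ℓ} 2 x)) (proj₂ (remQuot {ℓ} 2 x))

-- The degree of a terminal is the total size of the two groups that do not miss it. If each two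
-- groups have at least `m` vertices together, all three have at least `3m/2`; group sizes `h`, `h`,
-- `l` attain this, rounded up.
module Groups (m : ℕ) where
  h l : ℕ
  h = ⌈ m /2⌉
  l = ⌊ m /2⌋

  h+l : h + l ≡ m
  h+l = trans (+-comm h l) (⌊n/2⌋+⌈n/2⌉≡n m)

  group : Fin (h + (h + l)) → Fin 3
  group v = [ (λ _ → 0F) , [ (λ _ → 1F) , (λ _ → 2F) ]′ ∘ splitAt h ]′ (splitAt h v)

  open Extremal group public

  degree : ∀ i → size (not ∘ misses i) ≡
           size {h} (λ _ → not (does (0F ≟ i))) +
             (size {h} (λ _ → not (does (1F ≟ i))) + size {l} (λ _ → not (does (2F ≟ i))))
  degree i = trans (size-++ h _) (cong₂ _+_ (size-cong (λ v → cong (miss i) (first v)))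
    (trans (size-++ h _) (cong₂ _+_ (size-cong (λ v → cong (miss i) (second v)))
                                    (size-cong (λ v → cong (miss i) (third′ v))))))
    where
    miss : Fin 3 → Fin 3 → Bool
    miss i c = not (does (c ≟ i))
    first : ∀ v → group (v ↑ˡ (h + l)) ≡ 0F
    first v rewrite splitAt-↑ˡ h v (h + l) = refl
    second : ∀ v → group (h ↑ʳ (v ↑ˡ l)) ≡ 1F
    second v rewrite splitAt-↑ʳ h (h + l) (v ↑ˡ l) | splitAt-↑ˡ h v l = refl
    third′ : ∀ v → group (h ↑ʳ (h ↑ʳ v)) ≡ 2F
    third′ v rewrite splitAt-↑ʳ h (h + l) (h ↑ʳ v) | splitAt-↑ʳ h l v = refl

  degree₀ : size (not ∘ misses 0F) ≡ m
  degree₀ = trans (degree 0F) (trans (cong₂ _+_ (size-empty {h}) (cong₂ _+_ size-full size-full)) h+l)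

  degrees : ∀ i → m ≤ size (not ∘ misses i)
  degrees 0F = ≤-reflexive (sym degree₀)
  degrees 1F = ≤-reflexive (sym (trans (degree 1F) (
    trans (cong₂ _+_ size-full (cong₂ _+_ (size-empty {h}) size-full)) h+l)))
  degrees 2F = ≤-trans (≤-reflexive (sym h+l)) (≤-trans (+-monoʳ-≤ h (⌊n/2⌋≤⌈n/2⌉ m)) (≤-reflexive (sym
    (trans (degree 2F) (cong₂ _+_ size-full (trans (cong₂ _+_ size-full (size-empty {l})) (+-identityʳ h)))))))

  clique-size : h + (h + l) ≡ h + m
  clique-size = cong (h +_) h+l

-- Arithmetic of the bounds.

trees≤κ : ∀ k r → 3 * k + ⌈ r /2⌉ ≤ 4 * k + r
trees≤κ k r = +-mono-≤ (*-monoˡ-≤ k {3} {4} (s≤s (s≤s (s≤s z≤n)))) (⌈n/2⌉≤n r)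

-- For `r = 1` both sides agree, so the 1 gained by parity is used up there.
4trees≤3κ+1 : ∀ k r → r ≤ 3 → 4 * (3 * k + ⌈ r /2⌉) ≤ suc (3 * (4 * k + r))
4trees≤3κ+1 k r r≤3 = subst₂ _≤_ (sym (left k ⌈ r /2⌉)) (sym (right k r)) (+-monoʳ-≤ (12 * k) (small r r≤3))
  where
  left : ∀ k c → 4 * (3 * k + c) ≡ 12 * k + 4 * c
  left = solve-∀
  right : ∀ k r → suc (3 * (4 * k + r)) ≡ 12 * k + suc (3 * r)
  right = solve-∀
  small : ∀ r → r ≤ 3 → 4 * ⌈ r /2⌉ ≤ suc (3 * r)
  small 0 _ = z≤n
  small 1 _ = from-yes (4 ≤? 4)
  small 2 _ = from-yes (4 ≤? 7)
  small 3 _ = from-yes (8 ≤? 10)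
  small (suc (suc (suc (suc _)))) (s≤s (s≤s (s≤s ())))

⌈4k+r/2⌉ : ∀ k r → ⌈ 4 * k + r /2⌉ ≡ 2 * k + ⌈ r /2⌉
⌈4k+r/2⌉ zero    r = refl
⌈4k+r/2⌉ (suc k) r = trans (cong (λ x → ⌈ x /2⌉) (four k r))
  (trans (cong (λ x → suc (suc x)) (⌈4k+r/2⌉ k r)) (sym (two k ⌈ r /2⌉)))
  where
  four : ∀ k r → 4 * suc k + r ≡ suc (suc (suc (suc (4 * k + r))))
  four = solve-∀
  two : ∀ k c → 2 * suc k + c ≡ suc (suc (2 * k + c))
  two = solve-∀

-- The clique exceeds twice the claimed number of trees by 0 for `r` at most 1 and by 1 otherwise,
-- one vertex short of a further tree.
clique<2trees : ∀ k r → r ≤ 3 → ⌈ 4 * k + r /2⌉ + (4 * k + r) < suc (3 * k + ⌈ r /2⌉) * 2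
clique<2trees k r r≤3 = subst₂ _<_ (sym (trans (cong (_+ (4 * k + r)) (⌈4k+r/2⌉ k r)) (left k r ⌈ r /2⌉)))
  (sym (right k ⌈ r /2⌉)) (+-monoʳ-< (6 * k) (small r r≤3))
  where
  left : ∀ k r c → 2 * k + c + (4 * k + r) ≡ 6 * k + (c + r)
  left = solve-∀
  right : ∀ k c → suc (3 * k + c) * 2 ≡ 6 * k + (2 + c * 2)
  right = solve-∀
  small : ∀ r → r ≤ 3 → ⌈ r /2⌉ + r < 2 + ⌈ r /2⌉ * 2
  small 0 _ = from-yes (1 ≤? 2)
  small 1 _ = from-yes (3 ≤? 4)
  small 2 _ = from-yes (4 ≤? 4)
  small 3 _ = from-yes (6 ≤? 6)
  small (suc (suc (suc (suc _)))) (s≤s (s≤s (s≤s ())))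

theorem3 : ((n : ℕ) (G : Graph n) → 3 ≤ n → ConnectedGraph G →
    (k r : ℕ) → r ≤ 3 → IsConnectivity G (4 * k + r) →
    Kappa3AtLeast G (3 * k + ⌈ r /2⌉))
    ×
    ((k r : ℕ) → r ≤ 3 → 1 ≤ 4 * k + r →
    ∃ λ (n : ℕ) → ∃ λ (G : Graph n) →
    3 ≤ n × ConnectedGraph G × IsConnectivity G (4 * k + r) ×
    Kappa3Is G (3 * k + ⌈ r /2⌉))
theorem3 =
  (λ n G _ _ k r r≤3 conn → kappa3-bound G conn (trees≤κ k r) (4trees≤3κ+1 k r r≤3)) ,
  sharp
  where
  sharp : (k r : ℕ) → r ≤ 3 → 1 ≤ 4 * k + r → ∃ λ n → ∃ λ (G : Graph n) →
          3 ≤ n × ConnectedGraph G × IsConnectivity G (4 * k + r) × Kappa3Is G (3 * k + ⌈ r /2⌉)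
  sharp k r r≤3 pos = _ , G , m≤m+n 3 _ , connectedGraph (λ i → ≤-trans pos (degrees i)) , conn ,
    kappa3-bound G conn (trees≤κ k r) (4trees≤3κ+1 k r r≤3) ,
    S , ∣S∣≡3 , λ trees → <⇒≱ (clique<2trees k r r≤3) (≤-trans (Count.few trees) (≤-reflexive clique-size))
    where
    open Groups (4 * k + r)
    conn : IsConnectivity G (4 * k + r)
    conn = isConnectivity degrees degree₀ (≤-trans (m≤n+m _ h) (≤-reflexive (sym clique-size)))
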